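{- Let $\mathcal H=(V,E)$ be a connected hypergraph with a fixed ribbon structure, base node $b_0$ and base edge $b_0b_1$ on $\mathrm{Bip}\,\mathcal H$. Run the (ht:$E$, cut:$V$) Bernardi process on a hypertree $\mathbf f$ on $E$ and let $T$ be the resulting spanning tree. Then running the (ht:$V$, cut:$E$) Bernardi process on the hypertree $\mathbf f_V(T)$ on $V$, with base node $b_0$, base edge $b_0b_1^-$, and the reversed ribbon structure, also results in $T$.
   Context: $\mathcal H=(V,E)$: $V$ finite set, $E$ finite multiset of nonempty subsets of $V$; $\mathrm{Bip}\,\mathcal H$ has color classes $V$ (violet) and $E$ (emerald), $v$ joined to $e$ iff $v\in e$; connected means $\mathrm{Bip}\,\mathcal H$ connected. A ribbon structure assigns to each node $x$ a cyclic permutation of its incident edges; $xy^+$ (resp. $xy^-$) is the edge following (resp. preceding) $xy$ at $x$; subgraphs inherit restricted orders ($xy^+_G$ in subgraph $G$). The reversed ribbon structure inverts every cyclic permutation; $b_0b_1^-$ refers to the original structure. A hypertree on $E$ is $\mathbf f:E\to\mathbb Z_{\ge0}$ such that some spanning tree $T$ has $d_T(e)=\mathbf f(e)+1$ for all $e\in E$; symmetrically on $V$; $\mathbf f_V(T)(v)=d_T(v)-1$. Bernardi processes with hypertree $\mathbf f$ on $X\in\{E,V\}$, base node $b_0$, base edge $b_0b_1$ (for the given ribbon structure); current graph $G$ initially $\mathrm{Bip}\,\mathcal H$; outcome = final current graph. (ht:$X$, cut:$V$): if $b_0\in V$ start with current edge $b_0b_1$; if $b_0\in E$ start with $b_1b_0^+$,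 $b_0b_1$ counting as traversed from $b_0$. With current edge $ve$ ($v\in V$): if $\mathbf f$ is a hypertree on $X$ in $G-ve$, remove $ve$ and make $ve^+_G$ current; otherwise traverse $ve$ from $v$ and $ew:=ev^+_G$ from $e$, and make $we^+_G$ current. (ht:$X$, cut:$E$): if $b_0\in E$ start with $b_0b_1$; if $b_0\in V$ start with $b_1b_0^+$, $b_0b_1$ counting as traversed from $b_0$. With current edge $ev$ ($e\in E$): if $\mathbf f$ is a hypertree on $X$ in $G-ev$, remove $ev$ and make $ev^+_G$ current; otherwise traverse $ev$ from $e$ and $vd:=ve^+_G$ from $v$, and make $dv^+_G$ current. Each process stops right before an edge would be traversed a second time from the same endpoint. -}

module Defs where

open import Data.Nat using (ℕ; zero; suc; _+_; _∸_)
open import Data.Bool using (Bool; true; false; if_then_else_; _∧_; not)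
open import Data.Fin using (Fin; _≟_)
open import Data.Sum using (_⊎_; inj₁; inj₂)
open import Data.Product using (_×_; _,_; ∃-syntax; Σ)
open import Data.List using (List; []; _∷_; _++_; [_]; filter; map; allFin; reverse)
open import Data.Nat.ListAction using (sum)
open import Data.Bool using (T?)
open import Data.List.Membership.Propositional using (_∈_; _∉_)
open import Data.List.Relation.Unary.Unique.Propositional using (Unique)
open import Relation.Nullary using (¬_; does)
open import Relation.Binary.PropositionalEquality using (_≡_)
open import Function.Bundles using (_⇔_)

-- Hypergraphs H = (V,E) with V = Fin n, E = Fin m (E a multiset: edges
-- are indexed, several indices may carry the same vertex set).
-- mem v e = true  iff  v ∈ e  iff  v is joined to e in Bip H.

record Hypergraph : Set where
  field
    nV       : ℕ
    nE       : ℕ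
    mem      : Fin nV → Fin nE → Bool
    nonempty : ∀ (e : Fin nE) → ∃[ v ] mem v e ≡ true

open Hypergraph public

Node : ℕ → ℕ → Set
Node n m = Fin n ⊎ Fin m

-- A subgraph of the complete bipartite graph on V ⊎ E (edge set only;
-- all nodes are always present).  Edge vе present iff G v e = true.
Graph : ℕ → ℕ → Set
Graph n m = Fin n → Fin m → Bool

_─_ : ∀ {n m} → Graph n m → Fin n × Fin m → Graph n m
(G ─ (v , e)) v' e' = G v' e' ∧ not (does (v' ≟ v) ∧ does (e' ≟ e))

_⊆G_ : ∀ {n m} → Graph n m → Graph n m → Set
T ⊆G G = ∀ v e → T v e ≡ true → G v e ≡ true

data Reach {n m} (S : Graph n m) (x : Node n m) : Node n m → Set where
  here   : Reach S x x
  stepVE : ∀ v e → Reach S x (inj₁ v) → S v e ≡ true → Reach S x (inj₂ e)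
  stepEV : ∀ v e → Reach S x (inj₂ e) → S v e ≡ true → Reach S x (inj₁ v)

Connected : ∀ {n m} → Graph n m → Set
Connected S = ∀ x y → Reach S x y

-- Acyclic: no edge lies on a cycle, i.e. every edge is a bridge.
Acyclic : ∀ {n m} → Graph n m → Set
Acyclic S = ∀ v e → S v e ≡ true → ¬ Reach (S ─ (v , e)) (inj₁ v) (inj₂ e)

SpanningTree : ∀ {n m} → Graph n m → Graph n m → Set
SpanningTree G T = (T ⊆G G) × Connected T × Acyclic T

degE : ∀ {n m} → Graph n m → Fin m → ℕ
degE {n} T e = sum (map (λ v → if T v e then 1 else 0) (allFin n))

degV : ∀ {n m} → Graph n m → Fin n → ℕ
degV {n} {m} T v = sum (map (λ e → if T v e then 1 else 0) (allFin m))

IsHypertreeE : ∀ {n m} → Graph n m → (Fin m → ℕ) → Set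
IsHypertreeE G f = Σ _ λ T → SpanningTree G T × (∀ e → degE T e ≡ suc (f e))

IsHypertreeV : ∀ {n m} → Graph n m → (Fin n → ℕ) → Set
IsHypertreeV G f = Σ _ λ T → SpanningTree G T × (∀ v → degV T v ≡ suc (f v))

fV : ∀ {n m} → Graph n m → Fin n → ℕ
fV T v = degV T v ∸ 1

-- Ribbon structures.  The cyclic permutation at a node x is given by a
-- duplicate-free list enumerating the neighbours of x, read cyclically
-- (the successor of the last entry is the first one).

record RibbonData (n m : ℕ) : Set where
  constructor ribbon
  field
    atV : Fin n → List (Fin m)
    atE : Fin m → List (Fin n)

open RibbonData public

IsRibbon : (H : Hypergraph) → RibbonData (nV H) (nE H) → Set
IsRibbon H ρ =
  (∀ v → Unique (atV ρ v) × (∀ e → (e ∈ atV ρ v) ⇔ (mem H v e ≡ true))) ×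
  (∀ e → Unique (atE ρ e) × (∀ v → (v ∈ atE ρ e) ⇔ (mem H v e ≡ true)))

reverseRibbon : ∀ {n m} → RibbonData n m → RibbonData n m
reverseRibbon ρ = ribbon (λ v → reverse (atV ρ v)) (λ e → reverse (atE ρ e))

rotAfter : ∀ {k} → Fin k → List (Fin k) → List (Fin k)
rotAfter {k} x l = go [] l
  where
  go : List (Fin k) → List (Fin k) → List (Fin k)
  go pre []       = pre
  go pre (y ∷ ys) = if does (x ≟ y) then ys ++ pre ++ [ y ] else go (pre ++ [ y ]) ys

firstOr : ∀ {k} → Fin k → List (Fin k) → Fin k
firstOr d []      = d
firstOr d (y ∷ _) = y

nextAtV : ∀ {n m} → RibbonData n m → Graph n m → Fin n → Fin m → Fin m
nextAtV ρ G v e = firstOr e (filter (λ e' → T? (G v e')) (rotAfter e (atV ρ v)))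

nextAtE : ∀ {n m} → RibbonData n m → Graph n m → Fin m → Fin n → Fin n
nextAtE ρ G e v = firstOr v (filter (λ v' → T? (G v' e)) (rotAfter v (atE ρ e)))

data Base (n m : ℕ) : Set where
  baseV : Fin n → Fin m → Base n m   -- b₀ = v ∈ V, b₁ = e ∈ E
  baseE : Fin m → Fin n → Base n m   -- b₀ = e ∈ E, b₁ = v ∈ V

BaseOK : (H : Hypergraph) → Base (nV H) (nE H) → Set
BaseOK H (baseV v e) = mem H v e ≡ true
BaseOK H (baseE e v) = mem H v e ≡ true

basePred : ∀ {n m} → RibbonData n m → Graph n m → Base n m → Base n m
basePred ρ G (baseV v e) = baseV v (nextAtV (reverseRibbon ρ) G v e)
basePred ρ G (baseE e v) = baseE e (nextAtE (reverseRibbon ρ) G e v)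

Trav : ℕ → ℕ → Set
Trav n m = List (Fin n × Fin m)

-- (ht:X, cut:V) process.  HT G = "f is a hypertree on X in G".
-- RunCutV HT ρ G v e tV tE out : started in current graph G with current
-- edge ve (v ∈ V), tV = edges already traversed from their V-end, tE =
-- edges already traversed from their E-end, the process ends with
-- current graph out.
module CutV {n m : ℕ} (HT : Graph n m → Set) (ρ : RibbonData n m) where

  data Run : Graph n m → Fin n → Fin m → Trav n m → Trav n m → Graph n m → Set where
    remove : ∀ {G v e tV tE out} →
      HT (G ─ (v , e)) →
      Run (G ─ (v , e)) v (nextAtV ρ (G ─ (v , e)) v e) tV tE out →
      Run G v e tV tE out
    stop₁ : ∀ {G v e tV tE} →
      ¬ HT (G ─ (v , e)) → (v , e) ∈ tV →
      Run G v e tV tE G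
    stop₂ : ∀ {G v e tV tE} →
      ¬ HT (G ─ (v , e)) → (v , e) ∉ tV →
      (nextAtE ρ G e v , e) ∈ tE →
      Run G v e tV tE G
    traverse : ∀ {G v e tV tE out} →
      ¬ HT (G ─ (v , e)) → (v , e) ∉ tV →
      (nextAtE ρ G e v , e) ∉ tE →
      Run G (nextAtE ρ G e v) (nextAtV ρ G (nextAtE ρ G e v) e)
          ((v , e) ∷ tV) ((nextAtE ρ G e v , e) ∷ tE) out →
      Run G v e tV tE out

  Outcome : Graph n m → Base n m → Graph n m → Set
  Outcome G₀ (baseV v e) out = Run G₀ v e [] [] out
  Outcome G₀ (baseE e v) out = Run G₀ v (nextAtV ρ G₀ v e) [] ((v , e) ∷ []) out

module CutE {n m : ℕ} (HT : Graph n m → Set) (ρ : RibbonData n m) where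

  data Run : Graph n m → Fin m → Fin n → Trav n m → Trav n m → Graph n m → Set where
    remove : ∀ {G e v tV tE out} →
      HT (G ─ (v , e)) →
      Run (G ─ (v , e)) e (nextAtE ρ (G ─ (v , e)) e v) tV tE out →
      Run G e v tV tE out
    stop₁ : ∀ {G e v tV tE} →
      ¬ HT (G ─ (v , e)) → (v , e) ∈ tE →
      Run G e v tV tE G
    stop₂ : ∀ {G e v tV tE} →
      ¬ HT (G ─ (v , e)) → (v , e) ∉ tE →
      (v , nextAtV ρ G v e) ∈ tV →
      Run G e v tV tE G
    traverse : ∀ {G e v tV tE out} →
      ¬ HT (G ─ (v , e)) → (v , e) ∉ tE →
      (v , nextAtV ρ G v e) ∉ tV →
      Run G (nextAtV ρ G v e) (nextAtE ρ G (nextAtV ρ G v e) v)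
          ((v , nextAtV ρ G v e) ∷ tV) ((v , e) ∷ tE) out →
      Run G e v tV tE out

  Outcome : Graph n m → Base n m → Graph n m → Set
  Outcome G₀ (baseE e v) out = Run G₀ e v [] [] out
  Outcome G₀ (baseV v e) out = Run G₀ e (nextAtE ρ G₀ e v) ((v , e) ∷ []) [] out

BernardiEV : (H : Hypergraph) → RibbonData (nV H) (nE H) → Base (nV H) (nE H) →
             (Fin (nE H) → ℕ) → Graph (nV H) (nE H) → Set
BernardiEV H ρ b f out = CutV.Outcome (λ G → IsHypertreeE G f) ρ (mem H) b out

BernardiVE : (H : Hypergraph) → RibbonData (nV H) (nE H) → Base (nV H) (nE H) →
             (Fin (nV H) → ℕ) → Graph (nV H) (nE H) → Set
BernardiVE H ρ b f out = CutE.Outcome (λ G → IsHypertreeV G f) ρ (mem H) b out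

module Submission where

-- Walk around a spanning tree T along the ribbon structure: every dart (edge seen from one endpoint) is
-- met exactly once.  Call T a Jaeger tree if every non-edge is met from V before it is met from E.
--
-- If T is a Jaeger tree, the (ht:E, cut:V) process for f_E(T) follows this tour and ends in T.  An edge
-- ve of T cannot be removed: let S be the side of T − ve containing e; by the Jaeger property no other
-- edge of the current graph joins V ∖ S to E ∩ S, so a spanning tree avoiding ve with the same E-degrees
-- would have |S| edges inside S.
--
-- Every hypertree f is realised by a Jaeger tree: if we ∉ T is met first from e, exchange it for the
-- first edge of the path in T from e to w.  This keeps the E-degrees and lexicographically improves the
-- tour, if absence of edges is preferred at V and presence at E.  As the process is deterministic, its
-- outcome is this Jaeger tree.
--
-- The tour of T for the reversed ribbon structure, from the preceding base edge, is the original tour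
-- read backwards, so T is a Jaeger tree for it with V and E exchanged.

-- The base edge `b₀b₁⁻` comes from the closing of the tour. One turn crosses the edge if it lies in
-- `T` and then rotates. After one period the tour is back at `d₀`; undoing only the last rotation
-- leads to the predecessor of `d₀` at its node, which is the last dart of the tour, seen from the
-- other end if its edge is in `T`. From there on the reversed tour sees tree edges from the
-- opposite end and non-edges from the same end. The two meetings of a non-edge thus change their
-- order, and the exchange of `V` and `E` changes it back; this is why the Jaeger property survives.
--
-- The process and the tour have different clocks: the process never sees deleted edges, whereas the
-- tour rotates past them. The invariant of the process is therefore indexed by tour time, and one
-- step of the process may take several steps of the tour.
--
-- Graphs are Boolean functions, so a graph obtained by deletions is compared with a tree edge by
-- edge.

open import Defs
open import Data.Bool using (Bool; true; false; if_then_else_; _∧_; _∨_; not; _xor_; T?)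
import Data.Bool as Bool
import Data.Bool.Properties as Bool
open import Data.Empty using (⊥; ⊥-elim)
open import Data.Fin as Fin using (Fin; _≟_; toℕ)
import Data.Fin.Properties as Fin
open import Data.List as List using (List; []; _∷_; _++_; [_]; filter; foldl; reverse)
import Data.List.Membership.DecPropositional as DecMembership
open import Data.List.Membership.Propositional using (_∈_; _∉_)
open import Data.List.Membership.Propositional.Properties using (∈-∃++; ∈-++⁺ˡ; ∈-++⁺ʳ; ∈-++⁻)
open import Data.List.Properties as List using (++-assoc; ++-identityʳ; reverse-++; unfold-reverse; filter-all)
open import Data.List.Relation.Unary.All as All using ()
open import Data.List.Relation.Unary.AllPairs using ([]; _∷_)
open import Data.List.Relation.Unary.Any using (here; there)
open import Data.List.Relation.Unary.Any.Properties using (reverse⁺; reverse⁻)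
open import Data.List.Relation.Unary.Unique.Propositional using (Unique)
open import Data.List.Relation.Unary.Unique.Propositional.Properties using (++⁺; Unique[x∷xs]⇒x∉xs)
open import Data.Nat as ℕ using (ℕ; zero; suc; _+_; _*_; _≤_; _<_; z≤n; s≤s; _^_)
import Data.Nat.ListAction as ListAction
import Data.Nat.Properties as ℕ
open import Data.Product using (_×_; _,_; ∃-syntax; proj₁; proj₂)
import Data.Product.Properties as Product
open import Data.Sum as Sum using (_⊎_; inj₁; inj₂)
import Data.Sum.Properties as Sum
open import Function using (_∘_; _⇔_; Equivalence; mk⇔)
open import Relation.Binary.Definitions using (tri<; tri≈; tri>)
open import Relation.Binary.PropositionalEquality hiding ([_])
open import Relation.Nullary using (Dec; does; yes; no; ¬_)
open import Relation.Nullary.Decidable using (map′; _×-dec_; _⊎-dec_; ¬?)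
open import Algebra.Properties.CommutativeMonoid.Sum ℕ.+-0-commutativeMonoid using (sum; sum-cong-≗; ∑-distrib-+; ∑-comm; sum-replicate-zero)

-- The rotation at a node

-- The local function of rotAfter cannot be named; unification recovers it from a generalised unfolding.
mutual
  scan : ∀ {k} (x : Fin k) (l pre ys : List (Fin k)) → List (Fin k)
  scan x l pre ys = _

  private
   scan-solution : ∀ {k} (x y : Fin k) (ys : List (Fin k)) → rotAfter x (y ∷ ys) ≡ rotAfter x (y ∷ ys)
   scan-solution x y ys with does (x ≟ y)
   ... | true  = refl
   ... | false with y ∷ ys | y ∷ []
   ... | l | pre = refl {x = scan x l pre ys}

scan-∉ : ∀ {k} (x : Fin k) l pre as bs → x ∉ as →
         scan x l pre (as ++ x ∷ bs) ≡ bs ++ (pre ++ as) ++ [ x ]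
scan-∉ x l pre [] bs _ with x ≟ x
... | yes _ = cong (λ z → bs ++ z ++ [ x ]) (sym (++-identityʳ pre))
... | no x≢x = ⊥-elim (x≢x refl)
scan-∉ x l pre (a ∷ as) bs x∉ with x ≟ a
... | yes x≡a = ⊥-elim (x∉ (here x≡a))
... | no _ = trans (scan-∉ x l (pre ++ [ a ]) as bs (x∉ ∘ there))
                   (cong (λ z → bs ++ z ++ [ x ]) (++-assoc pre [ a ] as))

rotAfter-split : ∀ {k} (x : Fin k) as bs → x ∉ as → rotAfter x (as ++ x ∷ bs) ≡ bs ++ as ++ [ x ]
rotAfter-split x as bs = scan-∉ x (as ++ x ∷ bs) [] as bs

Unique-∉ : ∀ {k} {x : Fin k} as bs → Unique (as ++ x ∷ bs) → x ∉ as
Unique-∉ (a ∷ as) bs (a≢ ∷ _) (here x≡a) = All.lookup a≢ (∈-++⁺ʳ as (here refl)) (sym x≡a)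
Unique-∉ (a ∷ as) bs (_ ∷ u) (there x∈) = Unique-∉ as bs u x∈

next : ∀ {k} → List (Fin k) → Fin k → Fin k
next l x = firstOr x (rotAfter x l)

next-split : ∀ {k} {l : List (Fin k)} as x bs → Unique l → l ≡ as ++ x ∷ bs →
             next l x ≡ firstOr x (bs ++ as ++ [ x ])
next-split as x bs u refl = cong (firstOr x) (rotAfter-split x as bs (Unique-∉ as bs u))

lastOr : ∀ {k} → Fin k → List (Fin k) → Fin k
lastOr = foldl (λ _ y → y)

next-last : ∀ {k} {l : List (Fin k)} as x bs → Unique l → l ≡ as ++ x ∷ bs →
            next l (lastOr x bs) ≡ firstOr x (as ++ [ x ])
next-last as x [] u eq = next-split as x [] u eq
next-last as x (b ∷ bs) u eq =
  trans (next-last (as ++ [ x ]) b bs u (trans eq (sym (++-assoc as [ x ] (b ∷ bs)))))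
        (head-same as)
  where
  head-same : ∀ as → firstOr b ((as ++ [ x ]) ++ [ b ]) ≡ firstOr x (as ++ [ x ])
  head-same []      = refl
  head-same (_ ∷ _) = refl

data Chain {k} (nx : Fin k → Fin k) : Fin k → List (Fin k) → Set where
  []  : ∀ {x} → Chain nx x []
  _∷_ : ∀ {x y ys} → nx x ≡ y → Chain nx y ys → Chain nx x (y ∷ ys)

chain-append : ∀ {k} {nx : Fin k → Fin k} {x ys z zs} → Chain nx x ys → nx (lastOr x ys) ≡ z →
               Chain nx z zs → Chain nx x (ys ++ z ∷ zs)
chain-append [] p c = p ∷ c
chain-append (q ∷ c) p c' = q ∷ chain-append c p c'

chain-take : ∀ {k} {nx : Fin k → Fin k} {x} ys {z zs} → Chain nx x (ys ++ z ∷ zs) → Chain nx x (ys ++ [ z ])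
chain-take [] (p ∷ _) = p ∷ []
chain-take (_ ∷ ys) (p ∷ c) = p ∷ chain-take ys c

chain-segment : ∀ {k} {l : List (Fin k)} as x bs → Unique l → l ≡ as ++ x ∷ bs → Chain (next l) x bs
chain-segment as x [] u eq = []
chain-segment as x (b ∷ bs) u eq =
  next-split as x (b ∷ bs) u eq ∷
  chain-segment (as ++ [ x ]) b bs u (trans eq (sym (++-assoc as [ x ] (b ∷ bs))))

-- `rotAfter x l` is one full turn: the segment behind `x`, the jump from the end of the list to its
-- head, and the segment in front of `x`, ending in `x` itself.
chain-rotAfter : ∀ {k} {l : List (Fin k)} {x} → Unique l → x ∈ l → Chain (next l) x (rotAfter x l)
chain-rotAfter {x = x} u x∈ with ∈-∃++ x∈
... | as , bs , refl rewrite rotAfter-split x as bs (Unique-∉ as bs u) with as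
... | [] = chain-append (chain-segment [] x bs u refl) (next-last [] x bs u refl) []
... | a ∷ as' = chain-append (chain-segment (a ∷ as') x bs u refl) (next-last (a ∷ as') x bs u refl)
                  (chain-take as' (chain-segment [] a (as' ++ x ∷ bs) u refl))

∈-rotAfter : ∀ {k} {l : List (Fin k)} {x y} → Unique l → x ∈ l → y ∈ l → y ∈ rotAfter x l
∈-rotAfter {x = x} u x∈ y∈ with ∈-∃++ x∈
... | as , bs , refl rewrite rotAfter-split x as bs (Unique-∉ as bs u) with ∈-++⁻ as y∈
... | inj₁ y∈as = ∈-++⁺ʳ bs (∈-++⁺ˡ y∈as)
... | inj₂ (here refl) = ∈-++⁺ʳ bs (∈-++⁺ʳ as (here refl))
... | inj₂ (there y∈bs) = ∈-++⁺ˡ y∈bs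

rotAfter-∈ : ∀ {k} {l : List (Fin k)} {x y} → Unique l → x ∈ l → y ∈ rotAfter x l → y ∈ l
rotAfter-∈ {x = x} u x∈ y∈ with ∈-∃++ x∈
... | as , bs , refl rewrite rotAfter-split x as bs (Unique-∉ as bs u) with ∈-++⁻ bs y∈
... | inj₁ y∈bs = ∈-++⁺ʳ as (there y∈bs)
... | inj₂ y∈' with ∈-++⁻ as y∈'
... | inj₁ y∈as = ∈-++⁺ˡ y∈as
... | inj₂ (here refl) = x∈

next-∈ : ∀ {k} {l : List (Fin k)} {x} → Unique l → x ∈ l → next l x ∈ l
next-∈ {l = l} {x} u x∈ = rotAfter-∈ u x∈ (first-∈ (∈-rotAfter u x∈ x∈))
  where
  first-∈ : ∀ {ys} → x ∈ ys → firstOr x ys ∈ ys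
  first-∈ (here _)  = here refl
  first-∈ (there _) = here refl

-- A full turn from `x` passes every entry. This later spreads membership in the orbit of the tour
-- from one dart of a node to all of them.
next-transitive : ∀ {k} {l : List (Fin k)} (P : Fin k → Set) → Unique l → (∀ x → P x → P (next l x)) →
                  ∀ {x y} → x ∈ l → y ∈ l → P x → P y
next-transitive {l = l} P u closed x∈ y∈ = along (chain-rotAfter u x∈) (∈-rotAfter u x∈ y∈)
  where
  along : ∀ {x ys y} → Chain (next l) x ys → y ∈ ys → P x → P y
  along (refl ∷ _) (here refl) p = closed _ p
  along (refl ∷ c) (there y∈) p = along c y∈ (closed _ p)

Unique-reverse : ∀ {k} {l : List (Fin k)} → Unique l → Unique (reverse l)
Unique-reverse {l = []} u = u
Unique-reverse {l = x ∷ l} u@(_ ∷ u') rewrite unfold-reverse x l =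
  ++⁺ (Unique-reverse u') (All.[] ∷ [])
      (λ { (x∈ , here refl) → Unique[x∷xs]⇒x∉xs u (reverse⁻ x∈) })

next-reverse : ∀ {k} {l : List (Fin k)} {x} → Unique l → x ∈ l → next (reverse l) (next l x) ≡ x
next-reverse {x = x} u x∈ with ∈-∃++ x∈
... | as , b ∷ bs , refl =
  trans (cong (next (reverse (as ++ x ∷ b ∷ bs))) (next-split as x (b ∷ bs) u refl))
        (next-split (reverse bs) b (x ∷ reverse as) (Unique-reverse u) (reverse-split as bs))
  where
  reverse-split : ∀ as bs → reverse (as ++ x ∷ b ∷ bs) ≡ reverse bs ++ b ∷ x ∷ reverse as
  reverse-split as bs
    rewrite reverse-++ as (x ∷ b ∷ bs) | unfold-reverse x (b ∷ bs) | unfold-reverse b bs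
          | ++-assoc (reverse bs) [ b ] [ x ] = ++-assoc (reverse bs) (b ∷ x ∷ []) (reverse as)
... | [] , [] , refl =
  trans (cong (next [ x ]) (next-split [] x [] u refl)) (next-split [] x [] u refl)
... | a ∷ as , [] , refl =
  trans (cong (next (reverse (a ∷ as ++ [ x ]))) (next-split (a ∷ as) x [] u refl))
        (next-split (x ∷ reverse as) a [] (Unique-reverse u)
          (trans (unfold-reverse a (as ++ [ x ])) (cong (_++ [ a ]) (reverse-++ as [ x ]))))

-- The process jumps to the next edge of the current graph at once; `First` keeps the skipped
-- entries in between, which the tour has to pass one by one.
data First {k} (nx : Fin k → Fin k) (G : Fin k → Bool) : Fin k → Fin k → Set where
  found : ∀ {x} → G (nx x) ≡ true → First nx G x (nx x)
  skip  : ∀ {x y} → G (nx x) ≡ false → First nx G (nx x) y → First nx G x y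

first-filter : ∀ {k} {nx : Fin k → Fin k} (G : Fin k → Bool) {x d ys y} → Chain nx x ys →
               y ∈ ys → G y ≡ true → First nx G x (firstOr d (filter (λ z → T? (G z)) ys))
first-filter {nx = nx} G {x} (refl ∷ c) y∈ Gy with G (nx x) in eq
... | true = found eq
... | false with y∈
... | here refl with () ← trans (sym eq) Gy
... | there y∈' = skip eq (first-filter G c y∈' Gy)

first-next : ∀ {k} {l : List (Fin k)} (G : Fin k → Bool) {x y} → Unique l → x ∈ l → y ∈ l → G y ≡ true →
             First (next l) G x (firstOr x (filter (λ z → T? (G z)) (rotAfter x l)))
first-next G u x∈ y∈ Gy = first-filter G (chain-rotAfter u x∈) (∈-rotAfter u x∈ y∈) Gy

filter-next : ∀ {k} {l : List (Fin k)} (G : Fin k → Bool) {x} → Unique l → x ∈ l → (∀ {y} → y ∈ l → G y ≡ true) →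
              firstOr x (filter (λ z → T? (G z)) (rotAfter x l)) ≡ next l x
filter-next G {x} u x∈ all = cong (firstOr x) (filter-all (λ z → T? (G z))
   (All.tabulate (λ y∈ → subst Bool.T (sym (all (rotAfter-∈ u x∈ y∈))) _)))

-- Spanning trees and their cuts

edge? : ∀ {n m} (v v' : Fin n) (e e' : Fin m) → Dec (v' ≡ v × e' ≡ e)
edge? v v' e e' = v' ≟ v ×-dec e' ≟ e

─-true : ∀ {n m} (G : Graph n m) {v e v' e'} → G v' e' ≡ true → ¬ (v' ≡ v × e' ≡ e) → (G ─ (v , e)) v' e' ≡ true
─-true G {v} {e} {v'} {e'} p ne with v' ≟ v | e' ≟ e
... | yes q | yes r = ⊥-elim (ne (q , r))
... | yes _ | no _  rewrite p = refl
... | no _  | _     rewrite p = refl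

─-true⁻ : ∀ {n m} (G : Graph n m) {v e} v' e' → (G ─ (v , e)) v' e' ≡ true → G v' e' ≡ true × ¬ (v' ≡ v × e' ≡ e)
─-true⁻ G {v} {e} v' e' p with G v' e' | v' ≟ v | e' ≟ e
... | true | yes _ | no ne = refl , ne ∘ proj₂
... | true | no nv | _     = refl , nv ∘ proj₁

Reach-trans : ∀ {n m} {S : Graph n m} {x y z} → Reach S x y → Reach S y z → Reach S x z
Reach-trans p here = p
Reach-trans p (stepVE v e q s) = stepVE v e (Reach-trans p q) s
Reach-trans p (stepEV v e q s) = stepEV v e (Reach-trans p q) s

Reach-sym : ∀ {n m} {S : Graph n m} {x y} → Reach S x y → Reach S y x
Reach-sym here = here
Reach-sym (stepVE v e q s) = Reach-trans (stepEV v e here s) (Reach-sym q)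
Reach-sym (stepEV v e q s) = Reach-trans (stepVE v e here s) (Reach-sym q)

-- `Acyclic` only denies the existence of walks. A cut is the positive form of a bridge, a Boolean
-- colouring that separates the two components of `T ─ (v , e)`, and the crossing and counting
-- arguments compute with it.
record Cut {n m} (T : Graph n m) (v : Fin n) (e : Fin m) : Set where
  field
    side     : Node n m → Bool
    side-v   : side (inj₁ v) ≡ false
    side-e   : side (inj₂ e) ≡ true
    constant : ∀ v' e' → T v' e' ≡ true → ¬ (v' ≡ v × e' ≡ e) → side (inj₁ v') ≡ side (inj₂ e')

Tree : ∀ {n m} → Graph n m → Set
Tree T = Connected T × (∀ v e → T v e ≡ true → Cut T v e)

constant-Reach : ∀ {n m} {S : Graph n m} (c : Node n m → Bool) →
                 (∀ v e → S v e ≡ true → c (inj₁ v) ≡ c (inj₂ e)) → ∀ {x y} → Reach S x y → c x ≡ c y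
constant-Reach c k here = refl
constant-Reach c k (stepVE v e r s) = trans (constant-Reach c k r) (k v e s)
constant-Reach c k (stepEV v e r s) = trans (constant-Reach c k r) (sym (k v e s))

Tree⇒Acyclic : ∀ {n m} {T : Graph n m} → (∀ v e → T v e ≡ true → Cut T v e) → Acyclic T
Tree⇒Acyclic {T = T} cuts v e Tve r = false≢true (trans (sym side-v) (trans (constant-Reach side const' r) side-e))
  where
  false≢true : ¬ false ≡ true
  false≢true ()
  open Cut (cuts v e Tve)
  const' : ∀ v' e' → (T ─ (v , e)) v' e' ≡ true → side (inj₁ v') ≡ side (inj₂ e')
  const' v' e' p = let q , ne = ─-true⁻ T v' e' p in constant v' e' q ne

module _ {n m} {T : Graph n m} (v : Fin n) (e : Fin m) where
  private T' = T ─ (v , e)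

  -- After its last use of the edge `ve` the walk stays in `T'`, starting from the end of `ve` that
  -- it reached then.
  Reach-─ : ∀ {y} → Reach T (inj₂ e) y → Reach T' (inj₂ e) y ⊎ Reach T' (inj₁ v) y
  Reach-─ here = inj₁ here
  Reach-─ (stepVE v' e' r s) with edge? v v' e e' | Reach-─ r
  ... | yes (refl , refl) | _ = inj₁ here
  ... | no ne | inj₁ r' = inj₁ (stepVE v' e' r' (─-true T s ne))
  ... | no ne | inj₂ r' = inj₂ (stepVE v' e' r' (─-true T s ne))
  Reach-─ (stepEV v' e' r s) with edge? v v' e e' | Reach-─ r
  ... | yes (refl , refl) | _ = inj₂ here
  ... | no ne | inj₁ r' = inj₁ (stepEV v' e' r' (─-true T s ne))
  ... | no ne | inj₂ r' = inj₂ (stepEV v' e' r' (─-true T s ne))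

  private
    isLeft : ∀ {a b} {A : Set a} {B : Set b} → A ⊎ B → Bool
    isLeft (inj₁ _) = true
    isLeft (inj₂ _) = false

  -- A node is coloured by the alternative that `Reach-─` returns for one chosen walk from `e`. If
  -- the ends of another edge of `T` were coloured differently, that edge would complete a walk from
  -- `v` to `e` avoiding the bridge.
  bridge-cut : Connected T → ¬ Reach T' (inj₁ v) (inj₂ e) → Cut T v e
  bridge-cut conn bridge = record
    { side = λ y → isLeft (split y)
    ; side-v = side-v
    ; side-e = side-e
    ; constant = constant
    }
    where
    split : ∀ y → Reach T' (inj₂ e) y ⊎ Reach T' (inj₁ v) y
    split y = Reach-─ (conn (inj₂ e) y)
    side-v : isLeft (split (inj₁ v)) ≡ false
    side-v with split (inj₁ v)
    ... | inj₁ r = ⊥-elim (bridge (Reach-sym r))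
    ... | inj₂ _ = refl
    side-e : isLeft (split (inj₂ e)) ≡ true
    side-e with split (inj₂ e)
    ... | inj₁ _ = refl
    ... | inj₂ r = ⊥-elim (bridge r)
    constant : ∀ v' e' → T v' e' ≡ true → ¬ (v' ≡ v × e' ≡ e) → isLeft (split (inj₁ v')) ≡ isLeft (split (inj₂ e'))
    constant v' e' s ne with split (inj₁ v') | split (inj₂ e')
    ... | inj₁ _ | inj₁ _ = refl
    ... | inj₂ _ | inj₂ _ = refl
    ... | inj₁ r | inj₂ q = ⊥-elim (bridge (Reach-trans q (stepEV v' e' here (─-true T s ne) ⟫ Reach-sym r)))
      where _⟫_ = Reach-trans
    ... | inj₂ r | inj₁ q = ⊥-elim (bridge (Reach-trans r (stepVE v' e' here (─-true T s ne) ⟫ Reach-sym q)))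
      where _⟫_ = Reach-trans

SpanningTree⇒Tree : ∀ {n m} {G T : Graph n m} → SpanningTree G T → Tree T
SpanningTree⇒Tree (_ , conn , acyclic) = conn , λ v e s → bridge-cut v e conn (acyclic v e s)

-- Darts and tours

data Dart (n m : ℕ) : Set where
  vd ed : Fin n → Fin m → Dart n m

opp : ∀ {n m} → Dart n m → Dart n m
opp (vd v e) = ed v e
opp (ed v e) = vd v e

node : ∀ {n m} → Dart n m → Node n m
node (vd v e) = inj₁ v
node (ed v e) = inj₂ e

infix 5 _∋_

_∋_ : ∀ {n m} → Graph n m → Dart n m → Bool
G ∋ vd v e = G v e
G ∋ ed v e = G v e

on-opp : ∀ {n m} (G : Graph n m) d → G ∋ opp d ≡ G ∋ d
on-opp G (vd v e) = refl
on-opp G (ed v e) = refl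

opp-opp : ∀ {n m} (d : Dart n m) → opp (opp d) ≡ d
opp-opp (vd v e) = refl
opp-opp (ed v e) = refl

_≟ᵈ_ : ∀ {n m} (x y : Dart n m) → Dec (x ≡ y)
vd v e ≟ᵈ vd v' e' = map′ (λ { (refl , refl) → refl }) (λ { refl → refl , refl }) (v ≟ v' ×-dec e ≟ e')
ed v e ≟ᵈ ed v' e' = map′ (λ { (refl , refl) → refl }) (λ { refl → refl , refl }) (v ≟ v' ×-dec e ≟ e')
vd v e ≟ᵈ ed v' e' = no λ ()
ed v e ≟ᵈ vd v' e' = no λ ()

oppWhen : ∀ {n m} → Bool → Dart n m → Dart n m
oppWhen true  d = opp d
oppWhen false d = d

flip : ∀ {n m} → Graph n m → Dart n m → Dart n m
flip T d = oppWhen (T ∋ d) d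

flip-flip : ∀ {n m} (T : Graph n m) d → flip T (flip T d) ≡ d
flip-flip T d with T ∋ d in p
... | true rewrite on-opp T d | p = opp-opp d
... | false rewrite p = refl

flip-on : ∀ {n m} (T G : Graph n m) d → G ∋ flip T d ≡ G ∋ d
flip-on T G d with T ∋ d
... | true = on-opp G d
... | false = refl

rot : ∀ {n m} → RibbonData n m → Dart n m → Dart n m
rot ρ (vd v e) = vd v (next (atV ρ v) e)
rot ρ (ed v e) = ed (next (atE ρ e) v) e

node-rot : ∀ {n m} (ρ : RibbonData n m) d → node (rot ρ d) ≡ node d
node-rot ρ (vd v e) = refl
node-rot ρ (ed v e) = refl

RibbonOf : ∀ {n m} → Graph n m → RibbonData n m → Set
RibbonOf M ρ =
  (∀ v → Unique (atV ρ v) × (∀ e → (e ∈ atV ρ v) ⇔ (M v e ≡ true))) ×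
  (∀ e → Unique (atE ρ e) × (∀ v → (v ∈ atE ρ e) ⇔ (M v e ≡ true)))

module RibbonProperties {n m} {M : Graph n m} {ρ : RibbonData n m} (isρ : RibbonOf M ρ) where
  uniqueV : ∀ v → Unique (atV ρ v)
  uniqueV v = proj₁ (proj₁ isρ v)
  uniqueE : ∀ e → Unique (atE ρ e)
  uniqueE e = proj₁ (proj₂ isρ e)
  ∈V : ∀ {v e} → M v e ≡ true → e ∈ atV ρ v
  ∈V {v} {e} = Equivalence.from (proj₂ (proj₁ isρ v) e)
  ∈E : ∀ {v e} → M v e ≡ true → v ∈ atE ρ e
  ∈E {v} {e} = Equivalence.from (proj₂ (proj₂ isρ e) v)
  ∈V⁻ : ∀ {v e} → e ∈ atV ρ v → M v e ≡ true
  ∈V⁻ {v} {e} = Equivalence.to (proj₂ (proj₁ isρ v) e)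
  ∈E⁻ : ∀ {v e} → v ∈ atE ρ e → M v e ≡ true
  ∈E⁻ {v} {e} = Equivalence.to (proj₂ (proj₂ isρ e) v)

  rot-valid : ∀ d → M ∋ d ≡ true → M ∋ rot ρ d ≡ true
  rot-valid (vd v e) p = ∈V⁻ (next-∈ (uniqueV v) (∈V p))
  rot-valid (ed v e) p = ∈E⁻ (next-∈ (uniqueE e) (∈E p))

  rot-reverse : ∀ d → M ∋ d ≡ true → rot (reverseRibbon ρ) (rot ρ d) ≡ d
  rot-reverse (vd v e) p = cong (vd v) (next-reverse (uniqueV v) (∈V p))
  rot-reverse (ed v e) p = cong (λ w → ed w e) (next-reverse (uniqueE e) (∈E p))

-- The tour as an orbit and its period

module _ {P : ℕ → Set} (P? : ∀ k → Dec (P k)) where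

  least-below : ∀ b → (∀ i → i < b → ¬ P i) ⊎ (∃[ j ] j < b × P j × (∀ i → i < j → ¬ P i))
  least-below zero = inj₁ λ i ()
  least-below (suc b) with least-below b
  ... | inj₂ (j , j<b , q) = inj₂ (j , ℕ.m≤n⇒m≤1+n j<b , q)
  ... | inj₁ none with P? b
  ... | yes q = inj₂ (b , ℕ.≤-refl , q , none)
  ... | no ¬q = inj₁ none'
    where
    none' : ∀ i → i < suc b → ¬ P i
    none' i (s≤s i≤b) q with ℕ.m≤n⇒m<n∨m≡n i≤b
    ... | inj₁ i<b = none i i<b q
    ... | inj₂ refl = ¬q q

  least : ∀ {k} → P k → ∃[ j ] j ≤ k × P j × (∀ i → i < j → ¬ P i)
  least {k} p with least-below (suc k)
  ... | inj₁ none = ⊥-elim (none k ℕ.≤-refl p)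
  ... | inj₂ (j , s≤s j≤k , q) = j , j≤k , q

iterate : ∀ {A : Set} → (A → A) → A → ℕ → A
iterate f x zero = x
iterate f x (suc t) = f (iterate f x t)

dartCode : ∀ {n m} → Dart n m → Fin (2 * (n * m))
dartCode (vd v e) = Fin.combine {2} Fin.zero (Fin.combine v e)
dartCode (ed v e) = Fin.combine {2} (Fin.suc Fin.zero) (Fin.combine v e)

dartCode-injective : ∀ {n m} (x y : Dart n m) → dartCode x ≡ dartCode y → x ≡ y
dartCode-injective (vd v e) (vd v' e') p
  with refl , refl ← Fin.combine-injective v e v' e' (proj₂ (Fin.combine-injective {2} Fin.zero _ Fin.zero _ p)) = refl
dartCode-injective (ed v e) (ed v' e') p
  with refl , refl ← Fin.combine-injective v e v' e' (proj₂ (Fin.combine-injective {2} (Fin.suc Fin.zero) _ (Fin.suc Fin.zero) _ p)) = refl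
dartCode-injective (vd v e) (ed v' e') p with () ← proj₁ (Fin.combine-injective {2} Fin.zero (Fin.combine v e) (Fin.suc Fin.zero) (Fin.combine v' e') p)
dartCode-injective (ed v e) (vd v' e') p with () ← proj₁ (Fin.combine-injective {2} (Fin.suc Fin.zero) (Fin.combine v e) Fin.zero (Fin.combine v' e') p)

opaque
  -- The involution `flip T` followed by the rotation; both are invertible on the darts of the
  -- ambient graph, hence so is a turn.
  turn : ∀ {n m} → RibbonData n m → Graph n m → Dart n m → Dart n m
  turn ρ T d = rot ρ (flip T d)

  turn-def : ∀ {n m} (ρ : RibbonData n m) T d → turn ρ T d ≡ rot ρ (flip T d)
  turn-def ρ T d = refl

  tour : ∀ {n m} → RibbonData n m → Graph n m → Dart n m → ℕ → Dart n m
  tour ρ T = iterate (turn ρ T)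

  tour-zero : ∀ {n m} (ρ : RibbonData n m) T d → tour ρ T d zero ≡ d
  tour-zero ρ T d = refl

  tour-suc : ∀ {n m} (ρ : RibbonData n m) T d t → tour ρ T d (suc t) ≡ turn ρ T (tour ρ T d t)
  tour-suc ρ T d t = refl

module Tour {n m} (M : Graph n m) (ρ : RibbonData n m) (isρ : RibbonOf M ρ)
            (d₀ : Dart n m) (valid₀ : M ∋ d₀ ≡ true) (T : Graph n m) (T⊆M : T ⊆G M) where
  open RibbonProperties {M = M} {ρ} isρ

  step : Dart n m → Dart n m
  step = turn ρ T

  at : ℕ → Dart n m
  at = tour ρ T d₀

  at-zero : at 0 ≡ d₀
  at-zero = tour-zero ρ T d₀

  at-suc : ∀ t → at (suc t) ≡ step (at t)
  at-suc = tour-suc ρ T d₀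

  at-cong : ∀ {s t} → at s ≡ at t → at (suc s) ≡ at (suc t)
  at-cong {s} {t} eq = trans (at-suc s) (trans (cong step eq) (sym (at-suc t)))

  step-valid : ∀ d → M ∋ d ≡ true → M ∋ step d ≡ true
  step-valid d p = trans (cong (M ∋_) (turn-def ρ T d)) (rot-valid (flip T d) (trans (flip-on T M d) p))

  at-valid : ∀ t → M ∋ at t ≡ true
  at-valid zero = trans (cong (M ∋_) at-zero) valid₀
  at-valid (suc t) = trans (cong (M ∋_) (at-suc t)) (step-valid (at t) (at-valid t))

  unstep : Dart n m → Dart n m
  unstep d = flip T (rot (reverseRibbon ρ) d)

  unstep-step : ∀ d → M ∋ d ≡ true → unstep (step d) ≡ d
  unstep-step d p = trans (cong unstep (turn-def ρ T d))
    (trans (cong (flip T) (rot-reverse (flip T d) (trans (flip-on T M d) p))) (flip-flip T d))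

  step-cancel : ∀ x y → M ∋ x ≡ true → M ∋ y ≡ true → step x ≡ step y → x ≡ y
  step-cancel x y p q eq = trans (sym (unstep-step x p)) (trans (cong unstep eq) (unstep-step y q))

  -- Turns are injective on valid darts, so the orbit has no tail: every repetition comes from a
  -- return to `d₀` itself.
  at-cancel : ∀ k {i j} → at (k + i) ≡ at (k + j) → at i ≡ at j
  at-cancel zero eq = eq
  at-cancel (suc k) {i} {j} eq = at-cancel k
    (step-cancel _ _ (at-valid (k + i)) (at-valid (k + j))
      (trans (sym (at-suc (k + i))) (trans eq (at-suc (k + j)))))

  bound : ℕ
  bound = 2 * (n * m)

  repeat⇒return : ∀ {i j} → i < j → j ≤ bound → at i ≡ at j → ∃[ p ] p < bound × at (suc p) ≡ d₀
  repeat⇒return {i} i<j j≤ eq with ℕ.m≤n⇒∃[o]m+o≡n i<j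
  ... | p , refl = p , ℕ.≤-trans (s≤s (ℕ.m≤n+m p i)) j≤ ,
    trans (sym (at-cancel i (trans (cong at (ℕ.+-identityʳ i)) (trans eq (cong at (sym (ℕ.+-suc i p))))))) at-zero

  return : ∃[ p ] p < bound × at (suc p) ≡ d₀
  return = let i , j , i<j , eq = Fin.pigeonhole (ℕ.n<1+n bound) (λ i → dartCode (at (toℕ i))) in
    repeat⇒return i<j (Fin.toℕ≤pred[n] j) (dartCode-injective _ _ eq)

  abstract
    minimal-return : ∃[ p ] p ≤ proj₁ return × at (suc p) ≡ d₀ × (∀ i → i < p → ¬ at (suc i) ≡ d₀)
    minimal-return = least (λ k → at (suc k) ≟ᵈ d₀) (proj₂ (proj₂ return))

  period-1 : ℕ
  period-1 = proj₁ minimal-return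

  period : ℕ
  period = suc period-1

  period≤bound : period ≤ bound
  period≤bound = ℕ.≤-<-trans (proj₁ (proj₂ minimal-return)) (proj₁ (proj₂ return))

  at-period : at period ≡ d₀
  at-period = proj₁ (proj₂ (proj₂ minimal-return))

  at-injective : ∀ {i j} → i < j → j < period → ¬ at i ≡ at j
  at-injective {i} {j} i<j (s≤s j≤p) eq with ℕ.m≤n⇒∃[o]m+o≡n i<j
  ... | p , refl = proj₂ (proj₂ (proj₂ minimal-return)) p
    (ℕ.≤-trans (s≤s (ℕ.m≤n+m p i)) j≤p)
    (trans (sym (at-cancel i (trans (cong at (ℕ.+-identityʳ i)) (trans eq (cong at (sym (ℕ.+-suc i p))))))) at-zero)

  at-+period : ∀ t → at (t + period) ≡ at t
  at-+period zero = trans at-period (sym at-zero)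
  at-+period (suc t) = at-cong (at-+period t)

  at-+periods : ∀ k t → at (k * period + t) ≡ at t
  at-+periods zero t = refl
  at-+periods (suc k) t = trans (cong at shuffle) (trans (at-+period (k * period + t)) (at-+periods k t))
    where
    shuffle : period + k * period + t ≡ k * period + t + period
    shuffle = trans (ℕ.+-assoc period (k * period) t) (ℕ.+-comm period (k * period + t))

  Visited : ℕ → Dart n m → Set
  Visited t d = ∃[ s ] s < t × at s ≡ d

  -- A step beyond time `t` would start again behind time `s`. For the process this means that at a
  -- repeated dart the whole tour has been seen.
  repeat-visited : ∀ {s t} → s < t → at s ≡ at t → ∀ j → Visited t (at j)
  repeat-visited {t = t} s<t eq zero = zero , ℕ.≤-<-trans z≤n s<t , refl
  repeat-visited {s} {t} s<t eq (suc j) with repeat-visited s<t eq j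
  ... | r , r<t , p with ℕ.m≤n⇒m<n∨m≡n r<t
  ... | inj₁ sr<t = suc r , sr<t , at-cong p
  ... | inj₂ refl = s , s<t , trans eq (at-cong p)

  -- Crossing a tree edge

  module Crossing (c : Node n m → Bool) (D : Dart n m) (D∈T : T ∋ D ≡ true)
                  (crosses : ¬ c (node D) ≡ c (node (opp D)))
                  (only : ∀ x → T ∋ x ≡ true → x ≡ D ⊎ x ≡ opp D ⊎ c (node (opp x)) ≡ c (node x)) where

    colour : Dart n m → Bool
    colour d = c (node d)

    node-step : ∀ x → node (step x) ≡ node (flip T x)
    node-step x = trans (cong node (turn-def ρ T x)) (node-rot ρ (flip T x))

    colour-step : ∀ x → x ≡ D ⊎ x ≡ opp D ⊎ colour (step x) ≡ colour x
    colour-step x rewrite node-step x with T ∋ x in p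
    ... | true = only x p
    ... | false = inj₂ (inj₂ refl)

    colour-step-tree : ∀ x → T ∋ x ≡ true → colour (step x) ≡ colour (opp x)
    colour-step-tree x p rewrite node-step x | p = refl

    -- `D` and `opp D` are the only tree darts that change the colour, and `D` has the near colour.
    -- So the far colour, entered through `D`, can only be left through `opp D`.
    no-recrossing : ∀ {r} → at r ≡ D → ∀ k →
      colour (at (k + suc r)) ≡ colour (opp D) ⊎ (∃[ r' ] suc r ≤ r' × r' < k + suc r × at r' ≡ opp D)
    no-recrossing {r} eq zero =
      inj₁ (trans (cong colour (trans (at-suc r) (cong step eq))) (colour-step-tree D D∈T))
    no-recrossing {r} eq (suc k) with no-recrossing eq k
    ... | inj₂ (r' , lo , hi , p) = inj₂ (r' , lo , ℕ.m≤n⇒m≤1+n hi , p)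
    ... | inj₁ inside with colour-step (at (k + suc r))
    ... | inj₁ isD = ⊥-elim (crosses (trans (cong colour (sym isD)) inside))
    ... | inj₂ (inj₁ isOpp) = inj₂ (k + suc r , ℕ.m≤n+m (suc r) k , ℕ.≤-refl , isOpp)
    ... | inj₂ (inj₂ same) = inj₁ (trans (cong colour (at-suc (k + suc r))) (trans same inside))

    recrossing : ∀ {r u} → at r ≡ D → r < u → ¬ colour (at u) ≡ colour (opp D) →
                 ∃[ r' ] r < r' × r' < u × at r' ≡ opp D
    recrossing {r} {u} eq r<u outside with ℕ.m≤n⇒∃[o]m+o≡n r<u
    ... | k , p with refl ← trans (ℕ.+-comm k (suc r)) p with no-recrossing eq k
    ... | inj₁ inside = ⊥-elim (outside inside)
    ... | inj₂ recross = recross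

    -- The far colour is only ever entered through `D`, which leads to the dart of time `suc r`
    -- again. Later visits to it therefore repeat the arc up to `r'`, however often the tour has
    -- gone round.
    inside-arc : ∀ {r r'} → at r ≡ D → r < r' → at r' ≡ opp D → ∀ k →
                 colour (at (k + suc r)) ≡ colour (opp D) →
                 ∃[ s ] r < s × s ≤ r' × at s ≡ at (k + suc r)
    inside-arc {r} eq r<r' eq' zero _ = suc r , ℕ.≤-refl , r<r' , refl
    inside-arc {r} {r'} eq r<r' eq' (suc k) inside with colour (at (k + suc r)) Bool.≟ colour (opp D)
    ... | yes before with inside-arc eq r<r' eq' k before
    ... | s , r<s , s≤r' , p with ℕ.m≤n⇒m<n∨m≡n s≤r'
    ... | inj₁ s<r' = suc s , ℕ.m≤n⇒m≤1+n r<s , s<r' , at-cong p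
    ... | inj₂ refl = ⊥-elim (crosses (trans (cong colour (sym (opp-opp D)))
            (trans (sym (colour-step-tree (opp D) (trans (on-opp T D) D∈T)))
            (trans (cong (colour ∘ step) (trans (sym eq') p))
            (trans (cong colour (sym (at-suc (k + suc r)))) inside)))))
    inside-arc {r} {r'} eq r<r' eq' (suc k) inside | no ¬before with colour-step (at (k + suc r))
    ... | inj₁ isD = suc r , ℕ.≤-refl , r<r' , at-cong (trans eq (sym isD))
    ... | inj₂ (inj₁ isOpp) = ⊥-elim (¬before (cong colour isOpp))
    ... | inj₂ (inj₂ same) =
      ⊥-elim (¬before (trans (sym same) (trans (cong colour (sym (at-suc (k + suc r)))) inside)))

    visited-inside : ∀ {r u} → at r ≡ D → r < u → ¬ colour (at u) ≡ colour (opp D) →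
                     ∀ k → colour (at (k + suc r)) ≡ colour (opp D) →
                     ∃[ s ] r < s × s < u × at s ≡ at (k + suc r)
    visited-inside eq r<u outside k inside =
      let r' , r<r' , r'<u , eq' = recrossing eq r<u outside
          s , r<s , s≤r' , p = inside-arc eq r<r' eq' k inside
      in s , r<s , ℕ.≤-<-trans s≤r' r'<u , p

  module OnTree (tree : Tree T) where

    module CrossingAt {v e} (Tve : T v e ≡ true) where
      open Cut (proj₂ tree v e Tve) public

      sides-differ : ¬ side (inj₁ v) ≡ side (inj₂ e)
      sides-differ p with () ← trans (sym side-v) (trans p side-e)

      private
        only : ∀ x → T ∋ x ≡ true → x ≡ vd v e ⊎ x ≡ ed v e ⊎ side (node (opp x)) ≡ side (node x)
        only (vd v' e') p with edge? v v' e e'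
        ... | yes (refl , refl) = inj₁ refl
        ... | no ne = inj₂ (inj₂ (sym (constant v' e' p ne)))
        only (ed v' e') p with edge? v v' e e'
        ... | yes (refl , refl) = inj₂ (inj₁ refl)
        ... | no ne = inj₂ (inj₂ (constant v' e' p ne))

        only-swapped : ∀ x → T ∋ x ≡ true → x ≡ ed v e ⊎ x ≡ vd v e ⊎ side (node (opp x)) ≡ side (node x)
        only-swapped x p with only x p
        ... | inj₁ q = inj₂ (inj₁ q)
        ... | inj₂ (inj₁ q) = inj₁ q
        ... | inj₂ (inj₂ q) = inj₂ (inj₂ q)

      module FromV = Crossing side (vd v e) Tve sides-differ only
      module FromE = Crossing side (ed v e) Tve (sides-differ ∘ sym) only-swapped

    -- The tour is periodic, so an edge of T that is crossed must be crossed back.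
    opp-visited : ∀ d → T ∋ d ≡ true → ∀ {r} → at r ≡ d → ∃[ s ] at s ≡ opp d
    opp-visited (vd v e) p {r} eq =
      let open CrossingAt p
          s , _ , _ , q = FromV.recrossing {r} {r + period} eq (ℕ.m<m+n r (s≤s z≤n))
            (λ same → sides-differ (trans (cong (side ∘ node) (sym (trans (at-+period r) eq))) same))
      in s , q
    opp-visited (ed v e) p {r} eq =
      let open CrossingAt p
          s , _ , _ , q = FromE.recrossing {r} {r + period} eq (ℕ.m<m+n r (s≤s z≤n))
            (λ same → sides-differ (sym (trans (cong (side ∘ node) (sym (trans (at-+period r) eq))) same)))
      in s , q

    InOrbit : Dart n m → Set
    InOrbit d = ∃[ s ] at s ≡ d

    orbit-flip : ∀ d → InOrbit d → InOrbit (flip T d)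
    orbit-flip d (s , eq) with T ∋ d in p
    ... | true = opp-visited d p {s} eq
    ... | false = s , eq

    -- As `flip T` is an involution, `rot ρ d` is the turn of `flip T d`.
    orbit-rot : ∀ d → InOrbit d → InOrbit (rot ρ d)
    orbit-rot d o with orbit-flip d o
    ... | s , eq = suc s , trans (at-suc s) (trans (turn-def ρ T (at s)) (cong (rot ρ) (trans (cong (flip T) eq) (flip-flip T d))))

    NodeInOrbit : Node n m → Set
    NodeInOrbit x = ∀ d → M ∋ d ≡ true → node d ≡ x → InOrbit d

    node-in-orbit : ∀ d → M ∋ d ≡ true → InOrbit d → NodeInOrbit (node d)
    node-in-orbit (vd v e) p o (vd v e') p' refl =
      next-transitive (λ e → InOrbit (vd v e)) (uniqueV v) (λ e → orbit-rot (vd v e)) (∈V p) (∈V p') o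
    node-in-orbit (ed v e) p o (ed v' e) p' refl =
      next-transitive (λ v → InOrbit (ed v e)) (uniqueE e) (λ v → orbit-rot (ed v e)) (∈E p) (∈E p') o

    reach-in-orbit : ∀ {x y} → Reach T x y → NodeInOrbit x → NodeInOrbit y
    reach-in-orbit here o = o
    reach-in-orbit (stepVE v e r p) o = node-in-orbit (ed v e) (T⊆M v e p)
      (opp-visited (vd v e) p (proj₂ (reach-in-orbit r o (vd v e) (T⊆M v e p) refl)))
    reach-in-orbit (stepEV v e r p) o = node-in-orbit (vd v e) (T⊆M v e p)
      (opp-visited (ed v e) p (proj₂ (reach-in-orbit r o (ed v e) (T⊆M v e p) refl)))

    -- The orbit is closed under rotation, so it contains all darts of a node or none, and under
    -- crossing tree edges. Connectedness of `T` carries it from the base node to every node.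
    in-orbit : ∀ d → M ∋ d ≡ true → InOrbit d
    in-orbit d p = reach-in-orbit (proj₁ tree (node d₀) (node d)) (node-in-orbit d₀ valid₀ (zero , at-zero)) d p refl

    visited-from : ∀ t d → M ∋ d ≡ true → ∃[ k ] at (k + t) ≡ d
    visited-from t d p with in-orbit d p
    -- Adding `t` full periods to `s` gives a time that is at least `t`, because a period is
    -- positive.
    ... | s , eq = t * period-1 + s , trans (cong at shuffle) (trans (at-+periods t s) eq)
      where
      shuffle : t * period-1 + s + t ≡ t * period + s
      shuffle = trans (ℕ.+-comm _ t) (trans (sym (ℕ.+-assoc t (t * period-1) s)) (cong (_+ s) (sym (ℕ.*-suc t period-1))))

    visited-by-repeat : ∀ {s t} → s < t → at s ≡ at t → ∀ d → M ∋ d ≡ true → Visited t d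
    visited-by-repeat s<t eq d p with in-orbit d p
    ... | j , refl = repeat-visited s<t eq j

    visited-by-period : ∀ d → M ∋ d ≡ true → Visited period d
    visited-by-period = visited-by-repeat (s≤s z≤n) (trans at-zero (sym at-period))

    visited-after-crossing-V : ∀ {v e} (p : T v e ≡ true) → let open CrossingAt p in
      ∀ {r u} → at r ≡ vd v e → r < u → side (node (at u)) ≡ false →
      ∀ d → M ∋ d ≡ true → side (node d) ≡ true → ∃[ s ] r < s × s < u × at s ≡ d
    visited-after-crossing-V p {r} eq r<u outside d valid inside =
      let open CrossingAt p
          k , at-k = visited-from (suc r) d valid
          s , r<s , s<u , q = FromV.visited-inside eq r<u
            (λ same → sides-differ (trans side-v (trans (sym outside) same)))
            k (trans (cong (side ∘ node) at-k) (trans inside (sym side-e)))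
      in s , r<s , s<u , trans q at-k

    visited-after-crossing-E : ∀ {v e} (p : T v e ≡ true) → let open CrossingAt p in
      ∀ {r u} → at r ≡ ed v e → r < u → side (node (at u)) ≡ true →
      ∀ d → M ∋ d ≡ true → side (node d) ≡ false → ∃[ s ] r < s × s < u × at s ≡ d
    visited-after-crossing-E p {r} eq r<u outside d valid inside =
      let open CrossingAt p
          k , at-k = visited-from (suc r) d valid
          s , r<s , s<u , q = FromE.visited-inside eq r<u
            (λ same → sides-differ (trans (sym same) (trans outside (sym side-e))))
            k (trans (cong (side ∘ node) at-k) (trans inside (sym side-v)))
      in s , r<s , s<u , trans q at-k

-- Counting edges on one side of a cut

bit : Bool → ℕ
bit b = if b then 1 else 0

sum-allFin : ∀ {n} (f : Fin n → ℕ) → ListAction.sum (List.map f (List.allFin n)) ≡ sum f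
sum-allFin f = trans (cong ListAction.sum (List.map-tabulate (λ i → i) f)) (go f)
  where
  go : ∀ {n} (f : Fin n → ℕ) → ListAction.sum (List.tabulate f) ≡ sum f
  go {zero} f = refl
  go {suc n} f = cong (f Fin.zero +_) (go (f ∘ Fin.suc))

sum-mono : ∀ {n} {f g : Fin n → ℕ} → (∀ i → f i ≤ g i) → sum f ≤ sum g
sum-mono {zero} le = z≤n
sum-mono {suc n} le = ℕ.+-mono-≤ (le Fin.zero) (sum-mono (le ∘ Fin.suc))

at-index : ∀ {n} → Fin n → Fin n → ℕ → ℕ
at-index j i x = if does (j ≟ i) then x else 0

sum-at-index : ∀ {n} (j : Fin n) x → sum (λ i → at-index j i x) ≡ x
sum-at-index {suc n} Fin.zero x = trans (cong (x +_) (sum-replicate-zero n)) (ℕ.+-identityʳ x)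
sum-at-index (Fin.suc j) x = trans (sum-cong-≗ shift) (sum-at-index j x)
  where
  shift : ∀ i → at-index (Fin.suc j) (Fin.suc i) x ≡ at-index j i x
  shift i with j ≟ i
  ... | yes _ = refl
  ... | no _ = refl

_≟ⁿ_ : ∀ {n m} (x y : Node n m) → Dec (x ≡ y)
_≟ⁿ_ = Sum.≡-dec _≟_ _≟_

-- Parent edges in a rooted tree

module Rooted {n m} (S : Graph n m) (conn : Connected S) (r : Node n m) where

  Walk : ℕ → Node n m → Set
  Walk zero x = x ≡ r
  Walk (suc k) (inj₁ v) = ∃[ e ] S v e ≡ true × Walk k (inj₂ e)
  Walk (suc k) (inj₂ e) = ∃[ v ] S v e ≡ true × Walk k (inj₁ v)

  Walk? : ∀ x k → Dec (Walk k x)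
  Walk? x zero = x ≟ⁿ r
  Walk? (inj₁ v) (suc k) = Fin.any? (λ e → S v e Bool.≟ true ×-dec Walk? (inj₂ e) k)
  Walk? (inj₂ e) (suc k) = Fin.any? (λ v → S v e Bool.≟ true ×-dec Walk? (inj₁ v) k)

  walk : ∀ {x} → Reach S r x → ∃[ k ] Walk k x
  walk here = zero , refl
  walk (stepVE v e p s) = let k , w = walk p in suc k , v , s , w
  walk (stepEV v e p s) = let k , w = walk p in suc k , e , s , w

  abstract
    shortest : ∀ x → ∃[ k ] Walk k x × (∀ i → i < k → ¬ Walk i x)
    shortest x = let k , w = walk (conn r x)
                     j , _ , w' , min = least (Walk? x) {k} w
                 in j , w' , min

  dist : Node n m → ℕ
  dist x = proj₁ (shortest x)

  dist-≤ : ∀ {k} x → Walk k x → dist x ≤ k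
  dist-≤ x w = ℕ.≮⇒≥ (λ k<d → proj₂ (proj₂ (shortest x)) _ k<d w)

  parentV : ∀ v → ¬ inj₁ v ≡ r → ∃[ e ] S v e ≡ true × dist (inj₂ e) < dist (inj₁ v)
  parentV v ne with shortest (inj₁ v)
  ... | zero , w , _ = ⊥-elim (ne w)
  ... | suc k , (e , s , w) , _ = e , s , s≤s (dist-≤ (inj₂ e) w)

  parentE : ∀ e → ¬ inj₂ e ≡ r → ∃[ v ] S v e ≡ true × dist (inj₁ v) < dist (inj₂ e)
  parentE e ne with shortest (inj₂ e)
  ... | zero , w , _ = ⊥-elim (ne w)
  ... | suc k , (v , s , w) , _ = v , s , s≤s (dist-≤ (inj₁ v) w)

  module WithDefault (v₀ : Fin n) (e₀ : Fin m) where

    abstract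
      -- The root has no parent; the defaults only make the parent maps total. In the counting below
      -- the default of the root always carries weight 0.
      upV : Fin n → Fin m
      upV v with inj₁ v ≟ⁿ r
      ... | yes _ = e₀
      ... | no ne = proj₁ (parentV v ne)

      upE : Fin m → Fin n
      upE e with inj₂ e ≟ⁿ r
      ... | yes _ = v₀
      ... | no ne = proj₁ (parentE e ne)

      upV-edge : ∀ v → ¬ inj₁ v ≡ r → S v (upV v) ≡ true × dist (inj₂ (upV v)) < dist (inj₁ v)
      upV-edge v ne with inj₁ v ≟ⁿ r
      ... | yes eq = ⊥-elim (ne eq)
      ... | no ne' = proj₂ (parentV v ne')

      upE-edge : ∀ e → ¬ inj₂ e ≡ r → S (upE e) e ≡ true × dist (inj₁ (upE e)) < dist (inj₂ e)
      upE-edge e ne with inj₂ e ≟ⁿ r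
      ... | yes eq = ⊥-elim (ne eq)
      ... | no ne' = proj₂ (parentE e ne')

    avoiding : ∀ {v e} → (inj₁ v ≡ r ⊎ ¬ upV v ≡ e) → (inj₂ e ≡ r ⊎ ¬ upE e ≡ v) →
               ∀ k x → dist x < k → Reach (S ─ (v , e)) r x
    avoiding nv ne (suc k) x (s≤s d≤k) with x ≟ⁿ r
    ... | yes refl = here
    avoiding {v} {e} nv ne (suc k) (inj₁ v') (s≤s d≤k) | no v'≢r =
      stepEV v' (upV v') (avoiding nv ne k (inj₂ (upV v')) (ℕ.<-≤-trans (proj₂ (upV-edge v' v'≢r)) d≤k))
        (─-true S (proj₁ (upV-edge v' v'≢r)) (differ nv))
      where
      differ : (inj₁ v ≡ r ⊎ ¬ upV v ≡ e) → ¬ (v' ≡ v × upV v' ≡ e)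
      differ (inj₁ p) (refl , _) = v'≢r p
      differ (inj₂ p) (refl , q) = p q
    avoiding {v} {e} nv ne (suc k) (inj₂ e') (s≤s d≤k) | no e'≢r =
      stepVE (upE e') e' (avoiding nv ne k (inj₁ (upE e')) (ℕ.<-≤-trans (proj₂ (upE-edge e' e'≢r)) d≤k))
        (─-true S (proj₁ (upE-edge e' e'≢r)) (differ ne))
      where
      differ : (inj₂ e ≡ r ⊎ ¬ upE e ≡ v) → ¬ (upE e' ≡ v × e' ≡ e)
      differ (inj₁ p) (_ , refl) = e'≢r p
      differ (inj₂ p) (q , refl) = p q

    -- Every edge of a tree is the parent edge of one of its ends: otherwise the ancestral paths of
    -- both ends avoid it, and through the root they join its ends without it.
    all-edges-up : Acyclic S → ∀ {v e} → S v e ≡ true →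
                   (inj₁ v ≡ r ⊎ ¬ upV v ≡ e) → (inj₂ e ≡ r ⊎ ¬ upE e ≡ v) → ⊥
    all-edges-up acyclic {v} {e} s nv ne =
      acyclic v e s (Reach-trans (Reach-sym (reach (inj₁ v))) (reach (inj₂ e)))
      where
      reach : ∀ x → Reach (S ─ (v , e)) r x
      reach x = avoiding nv ne (suc (dist x)) x ℕ.≤-refl

-- Let each node other than the root own its parent edge.  In T rooted at v, every node on the side of e
-- owns an edge with an E-end there; in T' rooted at e, every such edge has an owner there, which is not e.
module CutCount {n m} {T T' : Graph n m} {v : Fin n} {e : Fin m} (Tve : T v e ≡ true) (conn : Connected T)
                (cut : Cut T v e) (conn' : Connected T') (acyclic' : Acyclic T')
                (degrees : ∀ e' → degE T' e' ≡ degE T e')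
                (closed : ∀ v' e' → T' v' e' ≡ true → Cut.side cut (inj₂ e') ≡ true → Cut.side cut (inj₁ v') ≡ true)
                where
  open Cut cut

  sideV : Fin n → Bool
  sideV v' = side (inj₁ v')
  sideE : Fin m → Bool
  sideE e' = side (inj₂ e')

  weight : Graph n m → Fin m → Fin n → ℕ
  weight G e' v' = if sideE e' then bit (G v' e') else 0

  total : Graph n m → ℕ
  total G = sum (λ e' → sum (weight G e'))

  total-eq : total T' ≡ total T
  total-eq = sum-cong-≗ row
    where
    row : ∀ e' → sum (weight T' e') ≡ sum (weight T e')
    row e' with sideE e'
    ... | false = refl
    ... | true = trans (sym (sum-allFin (λ v' → bit (T' v' e')))) (trans (degrees e') (sum-allFin (λ v' → bit (T v' e'))))

  module R = Rooted T conn (inj₁ v)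
  module R' = Rooted T' conn' (inj₂ e)
  open R.WithDefault v e using () renaming (upV to Q; upE to P; upV-edge to Q-edge; upE-edge to P-edge)
  open R'.WithDefault v e using (all-edges-up) renaming (upV to Q'; upE to P')

  -- No edge is charged twice: if each end were the parent of the other, each would be strictly
  -- closer to the root. At the root `v` itself the second charge vanishes, since `v` is not on the
  -- side of `e`.
  lower : ∀ e' v' → at-index (P e') v' (bit (sideE e')) + at-index (Q v') e' (bit (sideV v')) ≤ weight T e' v'
  lower e' v' with P e' ≟ v' | Q v' ≟ e'
  ... | no _ | no _ = z≤n
  ... | yes refl | no _ rewrite proj₁ (P-edge e' (λ ())) = ℕ.≤-reflexive (ℕ.+-identityʳ _)
  ... | no _ | yes refl with sideV v' in sv'
  ... | false = z≤n
  ... | true = subst (1 ≤_) (sym (cong₂ (λ b c → if b then bit c else 0) side-true (proj₁ (Q-edge v' (v'≢v ∘ Sum.inj₁-injective))))) ℕ.≤-refl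
    where
    v'≢v : ¬ v' ≡ v
    v'≢v refl with () ← trans (sym side-v) sv'
    side-true : sideE (Q v') ≡ true
    side-true = trans (sym (constant v' (Q v') (proj₁ (Q-edge v' (v'≢v ∘ Sum.inj₁-injective))) (v'≢v ∘ proj₁))) sv'
  lower e' v' | yes refl | yes q with P e' ≟ v
  ... | yes p rewrite p | side-v | sym p | proj₁ (P-edge e' (λ ())) = ℕ.≤-reflexive (ℕ.+-identityʳ _)
  ... | no ne = ⊥-elim (ℕ.<-asym (proj₂ (P-edge e' (λ ())))
                  (subst (λ z → R.dist (inj₂ z) < R.dist (inj₁ (P e'))) q (proj₂ (Q-edge (P e') (ne ∘ Sum.inj₁-injective)))))

  minusRoot : Fin m → ℕ
  minusRoot e' = if does (e ≟ e') then 0 else bit (sideE e')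

  -- `closed` puts the `V`-end on the side of `e` as well, so whichever end owns the edge is
  -- counted. The root `e` owns nothing, whence `minusRoot`; this is the deficit of one that yields
  -- the contradiction.
  upper : ∀ e' v' → weight T' e' v' ≤ at-index (P' e') v' (minusRoot e') + at-index (Q' v') e' (bit (sideV v'))
  upper e' v' with sideE e' in se' | T' v' e' in Te'
  ... | false | _ = z≤n
  ... | true | false = z≤n
  ... | true | true rewrite closed v' e' Te' se' with Q' v' ≟ e'
  ... | yes _ = ℕ.m≤n+m 1 _
  ... | no q with e ≟ e'
  ... | yes e≡e' = ⊥-elim (all-edges-up acyclic' Te' (inj₂ q) (inj₁ (cong inj₂ (sym e≡e'))))
  ... | no _ with P' e' ≟ v'
  ... | yes _ = ℕ.≤-refl
  ... | no p = ⊥-elim (all-edges-up acyclic' Te' (inj₂ q) (inj₂ p))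

  sumE sumV : ℕ
  sumE = sum (λ e' → bit (sideE e'))
  sumV = sum (λ v' → bit (sideV v'))

  sum-parents : (F : Fin m → Fin n) (F' : Fin n → Fin m) (f : Fin m → ℕ) (g : Fin n → ℕ) →
    sum (λ e' → sum (λ v' → at-index (F e') v' (f e') + at-index (F' v') e' (g v'))) ≡ sum f + sum g
  sum-parents F F' f g = begin
    sum (λ e' → sum (λ v' → at-index (F e') v' (f e') + at-index (F' v') e' (g v')))
      ≡⟨ sum-cong-≗ (λ e' → ∑-distrib-+ (λ v' → at-index (F e') v' (f e')) (λ v' → at-index (F' v') e' (g v'))) ⟩
    sum (λ e' → sum (λ v' → at-index (F e') v' (f e')) + sum (λ v' → at-index (F' v') e' (g v')))
      ≡⟨ ∑-distrib-+ (λ e' → sum (λ v' → at-index (F e') v' (f e'))) (λ e' → sum (λ v' → at-index (F' v') e' (g v'))) ⟩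
    sum (λ e' → sum (λ v' → at-index (F e') v' (f e'))) + sum (λ e' → sum (λ v' → at-index (F' v') e' (g v')))
      ≡⟨ cong₂ _+_ (sum-cong-≗ (λ e' → sum-at-index (F e') (f e')))
           (trans (∑-comm (λ e' v' → at-index (F' v') e' (g v'))) (sum-cong-≗ (λ v' → sum-at-index (F' v') (g v')))) ⟩
    sum f + sum g ∎
    where open ≡-Reasoning

  sum-minusRoot : suc (sum minusRoot) ≡ sumE
  sum-minusRoot = trans (cong (_+ sum minusRoot) (sym (sum-at-index e 1)))
    (trans (sym (∑-distrib-+ (λ e' → at-index e e' 1) minusRoot)) (sum-cong-≗ merge))
    where
    merge : ∀ e' → at-index e e' 1 + minusRoot e' ≡ bit (sideE e')
    merge e' with e ≟ e'
    ... | yes refl rewrite side-e = refl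
    ... | no _ = refl

  contradictory : ⊥
  contradictory = ℕ.<-irrefl refl (ℕ.+-cancelʳ-≤ sumV _ _ (begin
    suc (sum minusRoot) + sumV ≡⟨ cong (_+ sumV) sum-minusRoot ⟩
    sumE + sumV                ≡⟨ sum-parents P Q (bit ∘ sideE) (bit ∘ sideV) ⟨
    _                          ≤⟨ sum-mono (λ e' → sum-mono (lower e')) ⟩
    total T                    ≡⟨ total-eq ⟨
    total T'                   ≤⟨ sum-mono (λ e' → sum-mono (upper e')) ⟩
    _                          ≡⟨ sum-parents P' Q' minusRoot (bit ∘ sideV) ⟩
    sum minusRoot + sumV       ∎))
    where open ℕ.≤-Reasoning

-- The process on a Jaeger tree

infix 4 _∈ᵗ?_
_∈ᵗ?_ : ∀ {n m} (x : Fin n × Fin m) (l : Trav n m) → Dec (x ∈ l)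
x ∈ᵗ? l = DecMembership._∈?_ (Product.≡-dec _≟_ _≟_) x l

neighbourE : ∀ {n m} {T : Graph n m} {v e} → Reach T (inj₂ e) (inj₁ v) → ∃[ e' ] T v e' ≡ true
neighbourE (stepEV v e _ s) = e , s

Jaeger : ∀ {n m} → RibbonData n m → Graph n m → Dart n m → Set
Jaeger ρ T d₀ = ∀ t v e → tour ρ T d₀ t ≡ ed v e → T v e ≡ false → ∃[ s ] s < t × tour ρ T d₀ s ≡ vd v e

baseOf : ∀ {n m} → Dart n m → Base n m
baseOf (vd v e) = baseV v e
baseOf (ed v e) = baseE e v

module JaegerRun {n m} (M : Graph n m) (ρ : RibbonData n m) (isρ : RibbonOf M ρ)
                 (d₀ : Dart n m) (valid₀ : M ∋ d₀ ≡ true) (T : Graph n m) (spanning : SpanningTree M T)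
                 (jaeger : Jaeger ρ T d₀) (f : Fin m → ℕ) (degrees : ∀ e → degE T e ≡ suc (f e)) where

  T⊆M : T ⊆G M
  T⊆M = proj₁ spanning
  tree : Tree T
  tree = SpanningTree⇒Tree spanning

  open RibbonProperties {M = M} {ρ} isρ
  open Tour M ρ isρ d₀ valid₀ T T⊆M
  open OnTree tree

  HT : Graph n m → Set
  HT G = IsHypertreeE G f

  open CutV HT ρ

  step-off : ∀ {t} d → T ∋ d ≡ false → at t ≡ d → at (suc t) ≡ rot ρ d
  step-off {t} d off eq = trans (at-suc t) (trans (cong step eq) (trans (turn-def ρ T d)
    (cong (λ b → rot ρ (oppWhen b d)) off)))

  step-on : ∀ {t} d → T ∋ d ≡ true → at t ≡ d → at (suc t) ≡ rot ρ (opp d)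
  step-on {t} d on eq = trans (at-suc t) (trans (cong step eq) (trans (turn-def ρ T d)
    (cong (λ b → rot ρ (oppWhen b d)) on)))

  visited-suc : ∀ {t d} → Visited t d → Visited (suc t) d
  visited-suc (s , s<t , eq) = s , ℕ.m≤n⇒m≤1+n s<t , eq

  visited-now : ∀ {t d} → at t ≡ d → Visited (suc t) d
  visited-now {t} eq = t , ℕ.≤-refl , eq

  visited-suc⁻ : ∀ {t d} → Visited (suc t) d → Visited t d ⊎ at t ≡ d
  visited-suc⁻ (s , s≤s s≤t , eq) with ℕ.m≤n⇒m<n∨m≡n s≤t
  ... | inj₁ s<t = inj₁ (s , s<t , eq)
  ... | inj₂ refl = inj₂ eq

  -- `fresh` states that all non-tree edges met from `V` have been deleted. Soundness of the lists
  -- turns a stop into a repetition of the tour; `completeV` forces a stop once a full period has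
  -- passed.
  record Inv (t : ℕ) (G : Graph n m) (tV tE : Trav n m) : Set where
    field
      contains  : T ⊆G G
      within    : G ⊆G M
      fresh     : ∀ v e → G v e ≡ true → T v e ≡ false → ¬ Visited t (vd v e)
      soundV    : ∀ v e → (v , e) ∈ tV → Visited t (vd v e)
      completeV : ∀ v e → T v e ≡ true → Visited t (vd v e) → (v , e) ∈ tV
      soundE    : ∀ v e → (v , e) ∈ tE → Visited t (ed v e)

  module Steps {t G tV tE} (inv : Inv t G tV tE) where
    open Inv inv

    skipV : ∀ {v e} → at t ≡ vd v e → G v e ≡ false → Inv (suc t) G tV tE
    skipV {v} {e} eq off = record
      { contains = contains ; within = within ; fresh = fresh' ; soundV = λ v e p → visited-suc (soundV v e p)
      ; completeV = completeV' ; soundE = λ v e p → visited-suc (soundE v e p) }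
      where
      fresh' : ∀ v e → G v e ≡ true → T v e ≡ false → ¬ Visited (suc t) (vd v e)
      fresh' v' e' g n vis with visited-suc⁻ vis
      ... | inj₁ vis' = fresh v' e' g n vis'
      ... | inj₂ now with refl ← trans (sym eq) now with () ← trans (sym off) g
      completeV' : ∀ v e → T v e ≡ true → Visited (suc t) (vd v e) → (v , e) ∈ tV
      completeV' v' e' p vis with visited-suc⁻ vis
      ... | inj₁ vis' = completeV v' e' p vis'
      ... | inj₂ now with refl ← trans (sym eq) now with () ← trans (sym off) (contains v e p)

    passV : ∀ {v e} → at t ≡ vd v e → T v e ≡ true → Inv (suc t) G ((v , e) ∷ tV) tE
    passV {v} {e} eq on = record
      { contains = contains ; within = within ; fresh = fresh' ; soundV = soundV'
      ; completeV = completeV' ; soundE = λ v e p → visited-suc (soundE v e p) }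
      where
      fresh' : ∀ v e → G v e ≡ true → T v e ≡ false → ¬ Visited (suc t) (vd v e)
      fresh' v' e' g n vis with visited-suc⁻ vis
      ... | inj₁ vis' = fresh v' e' g n vis'
      ... | inj₂ now with refl ← trans (sym eq) now with () ← trans (sym on) n
      soundV' : ∀ v' e' → (v' , e') ∈ (v , e) ∷ tV → Visited (suc t) (vd v' e')
      soundV' v' e' (here refl) = visited-now eq
      soundV' v' e' (there p) = visited-suc (soundV v' e' p)
      completeV' : ∀ v' e' → T v' e' ≡ true → Visited (suc t) (vd v' e') → (v' , e') ∈ (v , e) ∷ tV
      completeV' v' e' p vis with visited-suc⁻ vis
      ... | inj₁ vis' = there (completeV v' e' p vis')
      ... | inj₂ now with refl ← trans (sym eq) now = here refl

    passE : ∀ {v e tE'} → at t ≡ ed v e → (∀ x → x ∈ tE' → x ≡ (v , e) ⊎ x ∈ tE) → Inv (suc t) G tV tE'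
    passE {v} {e} {tE'} eq new = record
      { contains = contains ; within = within ; fresh = fresh' ; soundV = λ v e p → visited-suc (soundV v e p)
      ; completeV = completeV' ; soundE = soundE' }
      where
      fresh' : ∀ v e → G v e ≡ true → T v e ≡ false → ¬ Visited (suc t) (vd v e)
      fresh' v' e' g n vis with visited-suc⁻ vis
      ... | inj₁ vis' = fresh v' e' g n vis'
      ... | inj₂ now with () ← trans (sym eq) now
      completeV' : ∀ v e → T v e ≡ true → Visited (suc t) (vd v e) → (v , e) ∈ tV
      completeV' v' e' p vis with visited-suc⁻ vis
      ... | inj₁ vis' = completeV v' e' p vis'
      ... | inj₂ now with () ← trans (sym eq) now
      soundE' : ∀ v' e' → (v' , e') ∈ tE' → Visited (suc t) (ed v' e')
      soundE' v' e' p with new (v' , e') p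
      ... | inj₁ refl = visited-now eq
      ... | inj₂ q = visited-suc (soundE v' e' q)

    cut : ∀ {v e} → at t ≡ vd v e → T v e ≡ false → Inv (suc t) (G ─ (v , e)) tV tE
    cut {v} {e} eq off = record
      { contains = λ v' e' p → ─-true G (contains v' e' p) (λ { (refl , refl) → true≢false (trans (sym p) off) })
      ; within = λ v' e' p → within v' e' (proj₁ (─-true⁻ G v' e' p))
      ; fresh = fresh' ; soundV = λ v e p → visited-suc (soundV v e p)
      ; completeV = completeV' ; soundE = λ v e p → visited-suc (soundE v e p) }
      where
      true≢false : ¬ true ≡ false
      true≢false ()
      fresh' : ∀ v' e' → (G ─ (v , e)) v' e' ≡ true → T v' e' ≡ false → ¬ Visited (suc t) (vd v' e')
      fresh' v' e' g n vis with ─-true⁻ G v' e' g | visited-suc⁻ vis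
      ... | g' , _ | inj₁ vis' = fresh v' e' g' n vis'
      ... | _ , ne | inj₂ now with refl ← trans (sym eq) now = ne (refl , refl)
      completeV' : ∀ v e → T v e ≡ true → Visited (suc t) (vd v e) → (v , e) ∈ tV
      completeV' v' e' p vis with visited-suc⁻ vis
      ... | inj₁ vis' = completeV v' e' p vis'
      ... | inj₂ now with refl ← trans (sym eq) now = ⊥-elim (true≢false (trans (sym p) off))

    removable : ∀ {v e} → T v e ≡ false → at t ≡ vd v e → HT (G ─ (v , e))
    removable off eq = T , (Inv.contains (cut eq off) , proj₂ spanning) , degrees

    -- Suppose that an edge of `T'` outside `T` has its `V`-end on the side of `v` and its `E`-end
    -- on the side of `e`. By `fresh` it is first met from `V` at some `u > t`, when the tour is
    -- back on the side of `v`. By then the whole side of `e` has been toured, so the edge was met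
    -- from `E` before `u`, and the Jaeger property gives a still earlier meeting from `V`.
    essential : ∀ {v e} → T v e ≡ true → at t ≡ vd v e → ¬ HT (G ─ (v , e))
    essential {v} {e} Tve eq (T' , (T'⊆ , conn' , acyclic') , degrees') =
      CutCount.contradictory {T = T} {T'} Tve (proj₁ tree) (proj₂ tree v e Tve) conn' acyclic'
        (λ e' → trans (degrees' e') (sym (degrees e'))) closed
      where
      open CrossingAt Tve
      closed : ∀ v' e' → T' v' e' ≡ true → side (inj₂ e') ≡ true → side (inj₁ v') ≡ true
      closed v' e' p inside with side (inj₁ v') in outside
      ... | true = refl
      ... | false with ─-true⁻ G v' e' (T'⊆ v' e' p)
      ... | g , ne with T v' e' in on
      ... | true = trans (sym outside) (trans (constant v' e' on ne) inside)
      ... | false = ⊥-elim (too-early (least (λ u → at u ≟ᵈ vd v' e') (proj₂ (in-orbit (vd v' e') (within v' e' g)))))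
        where
        too-early : ∀ {k} → (∃[ u ] u ≤ k × at u ≡ vd v' e' × (∀ i → i < u → ¬ at i ≡ vd v' e')) → ⊥
        too-early (u , _ , at-u , first) =
          let s , t<s , s<u , at-s = visited-after-crossing-V Tve eq t<u (trans (cong (side ∘ node) at-u) outside)
                                       (ed v' e') (within v' e' g) inside
              s' , s'<s , at-s' = jaeger s v' e' at-s on
          in first s' (ℕ.<-trans s'<s s<u) at-s'
          where
          t<u : t < u
          t<u with ℕ.<-cmp t u
          ... | tri< lt _ _ = lt
          ... | tri≈ _ refl _ with refl ← trans (sym eq) at-u = ⊥-elim (ne (refl , refl))
          ... | tri> _ _ gt = ⊥-elim (fresh v' e' g on (u , gt , at-u))

    -- A non-edge met from `E` was met from `V` before, and by `fresh` such an edge is no longer in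
    -- `G`.
    treeE : ∀ {v e} → at t ≡ ed v e → G v e ≡ true → T v e ≡ true
    treeE {v} {e} eq g with T v e in on
    ... | true = refl
    ... | false = ⊥-elim (fresh v e g on (jaeger t v e eq on))

    exhausted : (∀ d → M ∋ d ≡ true → Visited t d) → ∀ v e → G v e ≡ T v e
    exhausted all v e with T v e in on
    ... | true = contains v e on
    ... | false with G v e in g
    ... | false = refl
    ... | true = ⊥-elim (fresh v e g on (all (vd v e) (within v e g)))

  -- Synchronises the clocks: edges missing from `G` are missing from `T`, so the tour rotates past
  -- them and stays at `v`.
  advanceV : ∀ {G v e e' tV tE t} → First (next (atV ρ v)) (G v) e e' → at t ≡ vd v (next (atV ρ v) e) →
             Inv t G tV tE → ∃[ t' ] t ≤ t' × at t' ≡ vd v e' × G v e' ≡ true × Inv t' G tV tE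
  advanceV {t = t} (found g) eq inv = t , ℕ.≤-refl , eq , g , inv
  advanceV {G} {v} {e} {t = t} (skip off fst) eq inv =
    let t' , t<t' , rest = advanceV fst (step-off (vd v (next (atV ρ v) e)) tree-off eq) (Steps.skipV inv eq off)
    in t' , ℕ.<⇒≤ t<t' , rest
    where
    tree-off : T v (next (atV ρ v) e) ≡ false
    tree-off = Bool.¬-not (λ on → Bool.not-¬ off (Inv.contains inv _ _ on))

  advanceE : ∀ {G v v' e tV tE t} → First (next (atE ρ e)) (λ v → G v e) v v' → at t ≡ ed (next (atE ρ e) v) e →
             Inv t G tV tE → ∃[ t' ] t ≤ t' × at t' ≡ ed v' e × G v' e ≡ true × Inv t' G tV tE
  advanceE {t = t} (found g) eq inv = t , ℕ.≤-refl , eq , g , inv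
  advanceE {G} {v} {e = e} {t = t} (skip off fst) eq inv =
    let t' , t<t' , rest = advanceE {G} fst (step-off (ed (next (atE ρ e) v) e) tree-off eq)
                             (Steps.passE inv eq (λ _ → inj₂))
    in t' , ℕ.<⇒≤ t<t' , rest
    where
    tree-off : T (next (atE ρ e) v) e ≡ false
    tree-off = Bool.¬-not (λ on → Bool.not-¬ off (Inv.contains inv _ _ on))

  Completed : Graph n m → Fin n → Fin m → Trav n m → Trav n m → Set
  Completed G v e tV tE = ∃[ out ] Run G v e tV tE out × (∀ v e → out v e ≡ T v e)

  -- The fuel `k` covers the rest of a period. Once `period ≤ t`, every dart has been met: a current
  -- non-tree edge contradicts `fresh`, and a current tree edge is already in `tV`, which is a
  -- stopping case.
  run : ∀ k t {G v e tV tE} → period ≤ t + k → at t ≡ vd v e → G v e ≡ true → Inv t G tV tE → Completed G v e tV tE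
  run k t {G} {v} {e} {tV} {tE} fuel eq g inv with T v e in on
  run zero t {G} {v} {e} fuel eq g inv | false =
    ⊥-elim (Inv.fresh inv v e g on (s , ℕ.<-≤-trans s<p (subst (period ≤_) (ℕ.+-identityʳ t) fuel) , at-s))
    where
    now = visited-by-period (vd v e) (Inv.within inv v e g)
    s = proj₁ now
    s<p = proj₁ (proj₂ now)
    at-s = proj₂ (proj₂ now)
  run (suc k) t {G} {v} {e} {tV} {tE} fuel eq g inv | false =
    -- The successor of `ve` is sought in a graph without `ve`; the tree supplies another edge at
    -- `v`, so the search does not fall back on its default.
    let e'' , Tve'' = neighbourE (proj₁ tree (inj₂ e) (inj₁ v))
        inv' = Steps.cut inv eq on
        t' , t<t' , eq' , g' , inv'' = advanceV
          (first-next ((G ─ (v , e)) v) (uniqueV v) (∈V (Inv.within inv v e g)) (∈V (T⊆M v e'' Tve'')) (Inv.contains inv' v e'' Tve''))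
          (step-off (vd v e) on eq) inv'
        out , r , same = run k t' (ℕ.≤-trans fuel (ℕ.≤-trans (ℕ.≤-reflexive (ℕ.+-suc t k)) (ℕ.+-monoˡ-≤ k t<t'))) eq' g' inv''
    in out , remove (Steps.removable inv on eq) r , same
  run k t {G} {v} {e} {tV} {tE} fuel eq g inv | true with (v , e) ∈ᵗ? tV
  -- The dart was met before, so the tour has closed up, and `exhausted` leaves only the edges of
  -- `T` in `G`.
  ... | yes old = G , stop₁ (Steps.essential inv on eq) old ,
    (let s , s<t , at-s = Inv.soundV inv v e old
     in Steps.exhausted inv (visited-by-repeat s<t (trans at-s (sym eq))))
  ... | no new = traversing k fuel
    where
    crossed = advanceE {G} {t = suc t} (first-next (λ w → G w e) (uniqueE e) (∈E (Inv.within inv v e g)) (∈E (Inv.within inv v e g)) g)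
                (step-on (vd v e) on eq) (Steps.passV inv eq on)
    w = nextAtE ρ G e v
    t' = proj₁ crossed
    t<t' : t < t'
    t<t' = proj₁ (proj₂ crossed)
    eq' : at t' ≡ ed w e
    eq' = proj₁ (proj₂ (proj₂ crossed))
    g' : G w e ≡ true
    g' = proj₁ (proj₂ (proj₂ (proj₂ crossed)))
    inv' : Inv t' G ((v , e) ∷ tV) tE
    inv' = proj₂ (proj₂ (proj₂ (proj₂ crossed)))
    inv'' : Inv (suc t') G ((v , e) ∷ tV) ((w , e) ∷ tE)
    inv'' = Steps.passE inv' eq' (λ { _ (here p) → inj₁ p ; _ (there p) → inj₂ p })
    onward = advanceV {G} {t = suc t'}
               (first-next (G w) (uniqueV w) (∈V (Inv.within inv w e g')) (∈V (Inv.within inv w e g')) g')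
               (step-on (ed w e) (Steps.treeE inv' eq' g') eq') inv''

    traversing : ∀ k → period ≤ t + k → Completed G v e tV tE
    traversing zero fuel = ⊥-elim (new (Inv.completeV inv v e on
      (let s , s<p , at-s = visited-by-period (vd v e) (Inv.within inv v e g)
       in s , ℕ.<-≤-trans s<p (subst (period ≤_) (ℕ.+-identityʳ t) fuel) , at-s)))
    traversing (suc k) fuel with (w , e) ∈ᵗ? tE
    ... | yes old = G , stop₂ (Steps.essential inv on eq) new old ,
      (let s , s<t , at-s = Inv.soundE inv' w e old
       in Steps.exhausted inv' (visited-by-repeat s<t (trans at-s (sym eq'))))
    ... | no new' =
      let t'' , t'<t'' , eq'' , g'' , inv''' = onward
          out , r , same = run k t'' (ℕ.≤-trans fuel (ℕ.≤-trans (ℕ.≤-reflexive (ℕ.+-suc t k))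
                             (ℕ.+-monoˡ-≤ k (ℕ.≤-trans t<t' (ℕ.<⇒≤ t'<t''))))) eq'' g'' inv'''
      in out , traverse (Steps.essential inv on eq) new new' r , same

  initial : Inv 0 M [] []
  initial = record
    { contains = T⊆M ; within = λ v e p → p ; fresh = λ { v e g n (s , () , _) } ; soundV = λ v e ()
    ; completeV = λ { v e p (s , () , _) } ; soundE = λ v e () }

  outcome : ∀ d → d ≡ d₀ → ∃[ out ] Outcome M (baseOf d) out × (∀ v e → out v e ≡ T v e)
  outcome (vd v e) refl = run period 0 ℕ.≤-refl at-zero valid₀ initial
  outcome (ed v e) refl =
    -- No time precedes 0, so the Jaeger property forces a base edge seen from `E` into `T`; the
    -- tour crosses it, just as the process counts it as traversed.
    let Tve = Steps.treeE initial at-zero valid₀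
        t , _ , eq , g , inv = advanceV {M} (first-next (M v) (uniqueV v) (∈V valid₀) (∈V valid₀) valid₀)
          (step-on (ed v e) Tve at-zero) (Steps.passE initial at-zero (λ { _ (here p) → inj₁ p }))
    in run period t (ℕ.m≤n+m period t) eq g inv

-- Exchanges and the existence of Jaeger trees

Reach-mono : ∀ {n m} {S S' : Graph n m} → S ⊆G S' → ∀ {x y} → Reach S x y → Reach S' x y
Reach-mono inc here = here
Reach-mono inc (stepVE v e r s) = stepVE v e (Reach-mono inc r) (inc v e s)
Reach-mono inc (stepEV v e r s) = stepEV v e (Reach-mono inc r) (inc v e s)

-- The walk grows at its far end. Whenever it reuses the chosen edge `xe`, the loop is dropped and
-- the walk starts afresh at `x` or at `e`.
first-edge : ∀ {n m} {T : Graph n m} {e y} → Reach T (inj₂ e) y →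
             y ≡ inj₂ e ⊎ (∃[ x ] T x e ≡ true × Reach (T ─ (x , e)) (inj₁ x) y)
first-edge here = inj₁ refl
first-edge {T = T} {e} (stepVE v' e' r s) with first-edge r
... | inj₂ (x , p , r') with edge? x v' e e'
... | yes (refl , refl) = inj₁ refl
... | no ne = inj₂ (x , p , stepVE v' e' r' (─-true T s ne))
first-edge {T = T} {e} (stepEV v' e' r s) with first-edge r
... | inj₁ refl = inj₂ (v' , s , here)
... | inj₂ (x , p , r') with edge? x v' e e'
... | yes (refl , refl) = inj₂ (x , p , here)
... | no ne = inj₂ (x , p , stepEV v' e' r' (─-true T s ne))

swapEdge : ∀ {n m} → Graph n m → Fin m → Fin n → Fin n → Graph n m
swapEdge T e x w v' e' = (T ─ (x , e)) v' e' ∨ (does (v' ≟ w) ∧ does (e' ≟ e))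

module Exchange {n m} {T : Graph n m} (tree : Tree T) {e : Fin m} {x w : Fin n}
                (Txe : T x e ≡ true) (Twe : T w e ≡ false)
                (far : Cut.side (proj₂ tree x e Txe) (inj₁ w) ≡ false) where

  T″ : Graph n m
  T″ = swapEdge T e x w

  open Cut (proj₂ tree x e Txe)

  kept : ∀ v' e' → T v' e' ≡ true → ¬ (v' ≡ x × e' ≡ e) → T″ v' e' ≡ true
  kept v' e' p ne rewrite ─-true T p ne = refl

  added : T″ w e ≡ true
  added with w ≟ w | e ≟ e
  ... | yes _ | yes _ = Bool.∨-zeroʳ _
  ... | no ne | _ = ⊥-elim (ne refl)
  ... | yes _ | no ne = ⊥-elim (ne refl)

  edges″ : ∀ v' e' → T″ v' e' ≡ true → (v' ≡ w × e' ≡ e) ⊎ (T v' e' ≡ true × ¬ (v' ≡ x × e' ≡ e))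
  edges″ v' e' p with (T ─ (x , e)) v' e' in q
  ... | true = inj₂ (─-true⁻ T v' e' q)
  ... | false with v' ≟ w | e' ≟ e
  ... | yes a | yes b = inj₁ (a , b)

  x≢w : ¬ x ≡ w
  x≢w refl with () ← trans (sym Txe) Twe

  removed : T″ x e ≡ false
  removed = Bool.¬-not λ p → case (edges″ x e p)
    where
    case : ¬ ((x ≡ w × e ≡ e) ⊎ (T x e ≡ true × ¬ (x ≡ x × e ≡ e)))
    case (inj₁ (x≡w , _)) = x≢w x≡w
    case (inj₂ (_ , ne)) = ne (refl , refl)

  unchanged : ∀ v' e' → ¬ (v' ≡ x × e' ≡ e) → ¬ (v' ≡ w × e' ≡ e) → T″ v' e' ≡ T v' e'
  unchanged v' e' nx nw = by-value (T v' e') refl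
    where
    by-value : ∀ b → T v' e' ≡ b → T″ v' e' ≡ b
    by-value true p = kept v' e' p nx
    by-value false p = Bool.¬-not λ q → case (edges″ v' e' q)
      where
      case : ¬ ((v' ≡ w × e' ≡ e) ⊎ (T v' e' ≡ true × ¬ (v' ≡ x × e' ≡ e)))
      case (inj₁ q) = nw q
      case (inj₂ (q , _)) with () ← trans (sym p) q

  connected : Connected T″
  connected a b = Reach-trans (Reach-sym (from-e a)) (from-e b)
    where
    T-xe⊆ : (T ─ (x , e)) ⊆G T″
    T-xe⊆ v' e' p = let q , ne = ─-true⁻ T v' e' p in kept v' e' q ne
    constant' : ∀ v' e' → (T ─ (x , e)) v' e' ≡ true → side (inj₁ v') ≡ side (inj₂ e')
    constant' v' e' p = let q , ne = ─-true⁻ T v' e' p in constant v' e' q ne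
    x-to-w : Reach (T ─ (x , e)) (inj₁ x) (inj₁ w)
    x-to-w with Reach-─ x e (proj₁ tree (inj₂ e) (inj₁ w))
    ... | inj₂ r = r
    ... | inj₁ r with () ← trans (sym side-e) (trans (constant-Reach side constant' r) far)
    e-to-x : Reach T″ (inj₂ e) (inj₁ x)
    e-to-x = Reach-trans (stepEV w e here added) (Reach-sym (Reach-mono T-xe⊆ x-to-w))
    from-e : ∀ y → Reach T″ (inj₂ e) y
    from-e y with Reach-─ x e (proj₁ tree (inj₂ e) y)
    ... | inj₁ r = Reach-mono T-xe⊆ r
    ... | inj₂ r = Reach-trans e-to-x (Reach-mono T-xe⊆ r)

  -- The added edge inherits the cut of the deleted one. The cut of an old edge survives if `w` and
  -- `e` lie on the same side of it, and is otherwise corrected by the cut of the deleted edge.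
  cuts : ∀ a b → T″ a b ≡ true → Cut T″ a b
  cuts a b p with edges″ a b p
  ... | inj₁ (refl , refl) = record { side = side ; side-v = far ; side-e = side-e ; constant = constant″ }
    where
    constant″ : ∀ v' e' → T″ v' e' ≡ true → ¬ (v' ≡ w × e' ≡ e) → side (inj₁ v') ≡ side (inj₂ e')
    constant″ v' e' q ne with edges″ v' e' q
    ... | inj₁ q' = ⊥-elim (ne q')
    ... | inj₂ (q' , ne') = constant v' e' q' ne'
  ... | inj₂ (Tab , ab≢xe) with Cut.side (proj₂ tree a b Tab) (inj₁ w) Bool.≟ Cut.side (proj₂ tree a b Tab) (inj₂ e)
  ... | yes same = record { side = C.side ; side-v = C.side-v ; side-e = C.side-e ; constant = constant″ }
    where
    module C = Cut (proj₂ tree a b Tab)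
    constant″ : ∀ v' e' → T″ v' e' ≡ true → ¬ (v' ≡ a × e' ≡ b) → C.side (inj₁ v') ≡ C.side (inj₂ e')
    constant″ v' e' q ne with edges″ v' e' q
    ... | inj₁ (refl , refl) = same
    ... | inj₂ (q' , _) = C.constant v' e' q' ne
  ... | no differ = record { side = side″ ; side-v = side-a ; side-e = side-b ; constant = constant″ }
    where
    module C = Cut (proj₂ tree a b Tab)
    -- Neither cut is constant on the new edge; their symmetric difference is.
    side″ : Node n m → Bool
    side″ y = C.side y xor (side y xor side (inj₁ a))
    side-a : side″ (inj₁ a) ≡ false
    side-a rewrite C.side-v = Bool.xor-same (side (inj₁ a))
    side-b : side″ (inj₂ b) ≡ true
    side-b rewrite C.side-e | constant a b Tab ab≢xe = cong not (Bool.xor-same (side (inj₂ b)))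
    cancel : ∀ p q s → ¬ p ≡ q → p xor (false xor s) ≡ q xor (true xor s)
    cancel false false s ne = ⊥-elim (ne refl)
    cancel true true s ne = ⊥-elim (ne refl)
    cancel false true s ne = sym (Bool.not-involutive s)
    cancel true false s ne = refl
    constant″ : ∀ v' e' → T″ v' e' ≡ true → ¬ (v' ≡ a × e' ≡ b) → side″ (inj₁ v') ≡ side″ (inj₂ e')
    constant″ v' e' q ne with edges″ v' e' q
    ... | inj₁ (refl , refl) rewrite far | side-e = cancel _ _ (side (inj₁ a)) differ
    ... | inj₂ (q' , ne') = cong₂ (λ i j → i xor (j xor side (inj₁ a))) (C.constant v' e' q' ne) (constant v' e' q' ne')

  degrees : ∀ e' → degE T″ e' ≡ degE T e'
  degrees e' = trans (sum-allFin (λ v' → bit (T″ v' e'))) (trans (rows (e' ≟ e)) (sym (sum-allFin (λ v' → bit (T v' e')))))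
    where
    -- Column `e` loses `x` and gains `w`; indicators on both sides replace a subtraction.
    entry : ∀ v' → at-index x v' 1 + bit (T″ v' e) ≡ at-index w v' 1 + bit (T v' e)
    entry v' with x ≟ v' | w ≟ v'
    ... | yes refl | yes refl = ⊥-elim (x≢w refl)
    ... | yes refl | no _ = trans (cong (suc ∘ bit) removed) (sym (cong bit Txe))
    ... | no _ | yes refl = trans (cong bit added) (sym (cong (suc ∘ bit) Twe))
    ... | no x≢ | no w≢ = cong bit (unchanged v' e (x≢ ∘ sym ∘ proj₁) (w≢ ∘ sym ∘ proj₁))
    rows : Dec (e' ≡ e) → sum (λ v' → bit (T″ v' e')) ≡ sum (λ v' → bit (T v' e'))
    rows (no ne) = sum-cong-≗ (λ v' → cong bit (unchanged v' e' (ne ∘ proj₂) (ne ∘ proj₂)))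
    rows (yes refl) = ℕ.suc-injective (begin
      1 + sum (λ v' → bit (T″ v' e))
        ≡⟨ cong (_+ sum (λ v' → bit (T″ v' e))) (sum-at-index x 1) ⟨
      sum (λ v' → at-index x v' 1) + sum (λ v' → bit (T″ v' e))
        ≡⟨ ∑-distrib-+ (λ v' → at-index x v' 1) (λ v' → bit (T″ v' e)) ⟨
      sum (λ v' → at-index x v' 1 + bit (T″ v' e))
        ≡⟨ sum-cong-≗ entry ⟩
      sum (λ v' → at-index w v' 1 + bit (T v' e))
        ≡⟨ ∑-distrib-+ (λ v' → at-index w v' 1) (λ v' → bit (T v' e)) ⟩
      sum (λ v' → at-index w v' 1) + sum (λ v' → bit (T v' e))
        ≡⟨ cong (_+ sum (λ v' → bit (T v' e))) (sum-at-index w 1) ⟩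
      1 + sum (λ v' → bit (T v' e)) ∎)
      where open ≡-Reasoning

-- Lexicographic comparison of tours

code : (ℕ → Bool) → ℕ → ℕ
code b zero = 0
code b (suc k) = bit (b k) + (code b k + code b k)

bit≤1 : ∀ b → bit b ≤ 1
bit≤1 false = z≤n
bit≤1 true = ℕ.≤-refl

double : ∀ b c → suc (bit b + (c + c)) ≤ suc c + suc c
double b c = s≤s (ℕ.≤-trans (ℕ.+-monoˡ-≤ (c + c) (bit≤1 b)) (ℕ.≤-reflexive (sym (ℕ.+-suc c c))))

code-cong : ∀ {b b'} k → (∀ s → s < k → b s ≡ b' s) → code b k ≡ code b' k
code-cong zero eq = refl
code-cong (suc k) eq = cong₂ (λ i c → bit i + (c + c)) (eq k ℕ.≤-refl) (code-cong k (λ s s<k → eq s (ℕ.m≤n⇒m≤1+n s<k)))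

-- `code` is a binary number with time 0 as its leading digit, so an advantage at the first
-- difference outweighs all later digits. The lexicographic order thus becomes the order of bounded
-- natural numbers.
code-< : ∀ {b b'} {r} → (∀ s → s < r → b s ≡ b' s) → b r ≡ false → b' r ≡ true →
         ∀ k → r < k → code b k < code b' k
code-< {b} {b'} eq p q (suc k) (s≤s r≤k) with ℕ.m≤n⇒m<n∨m≡n r≤k
... | inj₁ r<k = ℕ.≤-trans (double (b k) (code b k))
        (ℕ.≤-trans (ℕ.+-mono-≤ (code-< eq p q k r<k) (code-< eq p q k r<k)) (ℕ.m≤n+m _ (bit (b' k))))
... | inj₂ refl rewrite p | q | code-cong k eq = ℕ.≤-refl

code-bound : ∀ b k → code b k < 2 ^ k
code-bound b zero = ℕ.≤-refl
code-bound b (suc k) = ℕ.≤-trans (double (b k) (code b k))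
  (ℕ.≤-trans (ℕ.+-mono-≤ (code-bound b k) (code-bound b k))
    (ℕ.≤-reflexive (cong (2 ^ k +_) (sym (ℕ.+-identityʳ (2 ^ k))))))

preferred : ∀ {n m} → Graph n m → Dart n m → Bool
preferred T (vd v e) = not (T v e)
preferred T (ed v e) = T v e

preferred-cong : ∀ {n m} (T T' : Graph n m) d → T ∋ d ≡ T' ∋ d → preferred T d ≡ preferred T' d
preferred-cong T T' (vd v e) eq = cong not eq
preferred-cong T T' (ed v e) eq = eq

module Improve {n m} (M : Graph n m) (ρ : RibbonData n m) (isρ : RibbonOf M ρ)
               (d₀ : Dart n m) (valid₀ : M ∋ d₀ ≡ true) where

  profile : Graph n m → ℕ → Bool
  profile T s = preferred T (tour ρ T d₀ s)

  -- The number of darts of the complete bipartite graph. Unlike the period it is the same for all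
  -- trees, so their profiles can be compared digit by digit.
  length-bound : ℕ
  length-bound = 2 * (n * m)

  value : Graph n m → ℕ
  value T = code (profile T) length-bound

  Early : Graph n m → ℕ → Fin n → Fin m → Set
  Early T t v e = ∃[ s ] s < t × tour ρ T d₀ s ≡ vd v e

  Early? : ∀ T t v e → Dec (Early T t v e)
  Early? T t v e = ℕ.anyUpTo? (λ s → tour ρ T d₀ s ≟ᵈ vd v e) t

  Violation : Graph n m → ℕ → Set
  Violation T t = ∃[ v ] ∃[ e ] tour ρ T d₀ t ≡ ed v e × T v e ≡ false × ¬ Early T t v e

  Violation? : ∀ T t → Dec (Violation T t)
  Violation? T t = Fin.any? λ v → Fin.any? λ e →
    (tour ρ T d₀ t ≟ᵈ ed v e) ×-dec (T v e Bool.≟ false) ×-dec ¬? (Early? T t v e)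

  -- A turn only asks whether the current edge is in the tree. Hence both tours still stand at the
  -- same dart at the time `r` of the first disagreement.
  tour-agree : ∀ T T' {r} → (∀ s → s < r → T ∋ tour ρ T d₀ s ≡ T' ∋ tour ρ T d₀ s) →
               ∀ s → s ≤ r → tour ρ T d₀ s ≡ tour ρ T' d₀ s
  tour-agree T T' agree zero _ = trans (tour-zero ρ T d₀) (sym (tour-zero ρ T' d₀))
  tour-agree T T' agree (suc s) s<r = begin
    tour ρ T d₀ (suc s)                 ≡⟨ tour-suc ρ T d₀ s ⟩
    turn ρ T (tour ρ T d₀ s)            ≡⟨ turn-def ρ T _ ⟩
    rot ρ (flip T (tour ρ T d₀ s))      ≡⟨ cong (λ b → rot ρ (oppWhen b (tour ρ T d₀ s))) (agree s s<r) ⟩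
    rot ρ (flip T' (tour ρ T d₀ s))     ≡⟨ turn-def ρ T' _ ⟨
    turn ρ T' (tour ρ T d₀ s)           ≡⟨ cong (turn ρ T') (tour-agree T T' agree s (ℕ.<⇒≤ s<r)) ⟩
    turn ρ T' (tour ρ T' d₀ s)          ≡⟨ tour-suc ρ T' d₀ s ⟨
    tour ρ T' d₀ (suc s)                ∎
    where open ≡-Reasoning

  value-< : ∀ T T' {r} → (∀ s → s < r → T ∋ tour ρ T d₀ s ≡ T' ∋ tour ρ T d₀ s) →
            preferred T (tour ρ T d₀ r) ≡ false → preferred T' (tour ρ T d₀ r) ≡ true →
            r < length-bound → value T < value T'
  value-< T T' {r} agree worse better =
    code-< same worse (trans (cong (preferred T') (sym (tour-agree T T' agree r ℕ.≤-refl))) better) length-bound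
    where
    same : ∀ s → s < r → profile T s ≡ profile T' s
    same s s<r = trans (preferred-cong T T' (tour ρ T d₀ s) (agree s s<r))
                       (cong (preferred T') (tour-agree T T' agree s (ℕ.<⇒≤ s<r)))

  module _ (T : Graph n m) (spanning : SpanningTree M T) where
    private
      T⊆M = proj₁ spanning
      tree = SpanningTree⇒Tree spanning
    open Tour M ρ isρ d₀ valid₀ T T⊆M
    open OnTree tree

    no-violation⇒Jaeger : (∀ t → t < length-bound → ¬ Violation T t) → Jaeger ρ T d₀
    no-violation⇒Jaeger none t v e eq off with t ℕ.<? length-bound
    ... | yes t<L = early t t<L eq
      where
      early : ∀ t → t < length-bound → at t ≡ ed v e → Early T t v e
      early t t<L eq with Early? T t v e
      ... | yes p = p
      ... | no ¬p = ⊥-elim (none t t<L (v , e , eq , off , ¬p))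
    -- A late time repeats one within the first period, which lies in the range searched for
    -- violations.
    ... | no t≮L with repeat-visited (s≤s z≤n) (trans at-zero (sym at-period)) t
    ... | t' , t'<p , eq' with Early? T t' v e
    ... | yes (s , s<t' , q) = s , ℕ.<-≤-trans s<t' (ℕ.<⇒≤ (ℕ.<-≤-trans (ℕ.<-≤-trans t'<p period≤bound) (ℕ.≮⇒≥ t≮L))) , q
    ... | no ¬p = ⊥-elim (none t' (ℕ.<-≤-trans t'<p period≤bound) (v , e , trans eq' eq , off , ¬p))

    -- The tours part at the first dart of the exchanged edges `xe` and `we`. At `vd x e` and at
    -- `ed w e` the new tree is the preferred one. It cannot be `vd w e`, by the violation. Were it
    -- `ed x e`, the tour would cross to the side of `x`, which contains `w`, and could be back at
    -- `e` at time `t` only after touring that whole side, including `vd w e`.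
    improve : ∀ {t} → t < length-bound → Violation T t →
              ∃[ T' ] SpanningTree M T' × (∀ e → degE T' e ≡ degE T e) × value T < value T'
    improve {t} t<L (w , e , at-t , Twe , late) with first-edge (proj₁ tree (inj₂ e) (inj₁ w))
    ... | inj₂ (x , Txe , r) = T″ , (T″⊆M , connected , Tree⇒Acyclic cuts) , degrees ,
      better (least touches? {t} (inj₂ (inj₂ (inj₁ at-t))))
      where
      open CrossingAt Txe
      far : side (inj₁ w) ≡ false
      far = trans (sym (constant-Reach side
              (λ v' e' p → let q , ne = ─-true⁻ T v' e' p in constant v' e' q ne) r)) side-v
      open Exchange tree Txe Twe far using (T″; connected; cuts; degrees; edges″; unchanged; added; removed; x≢w)

      T″⊆M : T″ ⊆G M
      T″⊆M v' e' p with edges″ v' e' p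
      ... | inj₁ (refl , refl) = subst (λ d → M ∋ d ≡ true) at-t (at-valid t)
      ... | inj₂ (q , _) = T⊆M v' e' q

      Touches : Dart n m → Set
      Touches d = d ≡ vd x e ⊎ d ≡ ed x e ⊎ d ≡ ed w e ⊎ d ≡ vd w e

      touches? : ∀ s → Dec (Touches (at s))
      touches? s = (at s ≟ᵈ vd x e) ⊎-dec (at s ≟ᵈ ed x e) ⊎-dec (at s ≟ᵈ ed w e) ⊎-dec (at s ≟ᵈ vd w e)

      untouched : ∀ d → ¬ Touches d → T ∋ d ≡ T″ ∋ d
      untouched (vd v' e') nt = sym (unchanged v' e' (λ { (refl , refl) → nt (inj₁ refl) })
                                       (λ { (refl , refl) → nt (inj₂ (inj₂ (inj₂ refl))) }))
      untouched (ed v' e') nt = sym (unchanged v' e' (λ { (refl , refl) → nt (inj₂ (inj₁ refl)) })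
                                       (λ { (refl , refl) → nt (inj₂ (inj₂ (inj₁ refl))) }))

      earlier : ∀ {r d} → r ≤ t → at r ≡ d → ¬ d ≡ ed w e → r < t
      earlier r≤t at-r ne with ℕ.m≤n⇒m<n∨m≡n r≤t
      ... | inj₁ r<t = r<t
      ... | inj₂ refl = ⊥-elim (ne (trans (sym at-r) at-t))

      better : (∃[ r ] r ≤ t × Touches (at r) × (∀ i → i < r → ¬ Touches (at i))) → value T < value T″
      better (r , r≤t , touch , first) with touch
      ... | inj₁ at-r = value-< T T″ {r} (λ s s<r → untouched (at s) (first s s<r))
              (trans (cong (preferred T) at-r) (cong not Txe)) (trans (cong (preferred T″) at-r) (cong not removed))
              (ℕ.≤-<-trans r≤t t<L)
      ... | inj₂ (inj₂ (inj₁ at-r)) = value-< T T″ {r} (λ s s<r → untouched (at s) (first s s<r))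
              (trans (cong (preferred T) at-r) Twe) (trans (cong (preferred T″) at-r) added)
              (ℕ.≤-<-trans r≤t t<L)
      ... | inj₂ (inj₂ (inj₂ at-r)) = ⊥-elim (late (r , earlier r≤t at-r (λ ()) , at-r))
      ... | inj₂ (inj₁ at-r) =
        let s , _ , s<t , at-s = visited-after-crossing-E Txe at-r (earlier r≤t at-r (λ { refl → x≢w refl }))
                                   (trans (cong (side ∘ node) at-t) side-e)
                                   (vd w e) (subst (λ d → M ∋ d ≡ true) at-t (at-valid t)) far
        in ⊥-elim (late (s , s<t , at-s))

  -- Values stay below `2 ^ length-bound` and every exchange raises them, so the fuel `k` bounds the
  -- number of exchanges still possible.
  jaeger-realisation : ∀ k T → SpanningTree M T → 2 ^ length-bound ≤ value T + k →
    ∃[ T' ] SpanningTree M T' × (∀ e → degE T' e ≡ degE T e) × Jaeger ρ T' d₀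
  jaeger-realisation k T spanning fuel with ℕ.anyUpTo? (Violation? T) length-bound
  ... | no none = T , spanning , (λ _ → refl) ,
        no-violation⇒Jaeger T spanning (λ t t<L viol → none (t , t<L , viol))
  jaeger-realisation zero T spanning fuel | yes _ =
    ⊥-elim (ℕ.<⇒≱ (code-bound (profile T) length-bound) (subst (2 ^ length-bound ≤_) (ℕ.+-identityʳ (value T)) fuel))
  jaeger-realisation (suc k) T spanning fuel | yes (t , t<L , viol) =
    let T' , spanning' , deg' , lt = improve T spanning t<L viol
        T* , spanning* , deg* , jaeger = jaeger-realisation k T' spanning'
          (ℕ.≤-trans fuel (ℕ.≤-trans (ℕ.≤-reflexive (ℕ.+-suc (value T) k)) (ℕ.+-monoˡ-≤ k lt)))
    in T* , spanning* , (λ e → trans (deg* e) (deg' e)) , jaeger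

-- Determinism of the process

run-deterministic : ∀ {n m} {HT : Graph n m → Set} {ρ : RibbonData n m} {G v e tV tE out out'} →
  CutV.Run HT ρ G v e tV tE out → CutV.Run HT ρ G v e tV tE out' → out ≡ out'
run-deterministic (CutV.remove _ r) (CutV.remove _ r') = run-deterministic r r'
run-deterministic (CutV.remove h _) (CutV.stop₁ ¬h _) = ⊥-elim (¬h h)
run-deterministic (CutV.remove h _) (CutV.stop₂ ¬h _ _) = ⊥-elim (¬h h)
run-deterministic (CutV.remove h _) (CutV.traverse ¬h _ _ _) = ⊥-elim (¬h h)
run-deterministic (CutV.stop₁ ¬h _) (CutV.remove h _) = ⊥-elim (¬h h)
run-deterministic (CutV.stop₁ _ _) (CutV.stop₁ _ _) = refl
run-deterministic (CutV.stop₁ _ _) (CutV.stop₂ _ _ _) = refl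
run-deterministic (CutV.stop₁ _ p) (CutV.traverse _ q _ _) = ⊥-elim (q p)
run-deterministic (CutV.stop₂ ¬h _ _) (CutV.remove h _) = ⊥-elim (¬h h)
run-deterministic (CutV.stop₂ _ _ _) (CutV.stop₁ _ _) = refl
run-deterministic (CutV.stop₂ _ _ _) (CutV.stop₂ _ _ _) = refl
run-deterministic (CutV.stop₂ _ _ p) (CutV.traverse _ _ q _) = ⊥-elim (q p)
run-deterministic (CutV.traverse ¬h _ _ _) (CutV.remove h _) = ⊥-elim (¬h h)
run-deterministic (CutV.traverse _ q _ _) (CutV.stop₁ _ p) = ⊥-elim (q p)
run-deterministic (CutV.traverse _ _ q _) (CutV.stop₂ _ _ p) = ⊥-elim (q p)
run-deterministic (CutV.traverse _ _ _ r) (CutV.traverse _ _ _ r') = run-deterministic r r'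

-- Interchanging V and E

_ᵀ : ∀ {n m} → Graph n m → Graph m n
(G ᵀ) e v = G v e

_ᴿ : ∀ {n m} → RibbonData n m → RibbonData m n
ρ ᴿ = ribbon (atE ρ) (atV ρ)

mirror : ∀ {n m} → Dart n m → Dart m n
mirror (vd v e) = ed e v
mirror (ed v e) = vd e v

mirror-mirror : ∀ {n m} (d : Dart n m) → mirror (mirror d) ≡ d
mirror-mirror (vd v e) = refl
mirror-mirror (ed v e) = refl

Reach-mirror : ∀ {n m} {S : Graph n m} {S' : Graph m n} → (∀ v e → S v e ≡ true → S' e v ≡ true) →
               ∀ {x y} → Reach S x y → Reach S' (Sum.swap x) (Sum.swap y)
Reach-mirror inc here = here
Reach-mirror inc (stepVE v e r s) = stepEV e v (Reach-mirror inc r) (inc v e s)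
Reach-mirror inc (stepEV v e r s) = stepVE e v (Reach-mirror inc r) (inc v e s)

SpanningTree-mirror : ∀ {n m} {G T : Graph n m} {G' : Graph m n} → (∀ v e → G v e ≡ true → G' e v ≡ true) →
                      SpanningTree G T → SpanningTree G' (T ᵀ)
SpanningTree-mirror {T = T} inc (T⊆G , conn , acyclic) =
  (λ e v p → inc v e (T⊆G v e p)) ,
  (λ x y → subst₂ (Reach (T ᵀ)) (Sum.swap-involutive x) (Sum.swap-involutive y)
             (Reach-mirror (λ v e p → p) (conn (Sum.swap x) (Sum.swap y)))) ,
  (λ e v p r → acyclic v e p (Reach-sym (Reach-mirror
    (λ e' v' q → let q' , ne = ─-true⁻ (T ᵀ) e' v' q in ─-true T q' (λ (a , b) → ne (b , a))) r)))

─-mirror : ∀ {n m} {G : Graph n m} {G' : Graph m n} {v e} → (∀ v e → G' e v ≡ G v e) →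
           ∀ v' e' → (G' ─ (e , v)) e' v' ≡ (G ─ (v , e)) v' e'
─-mirror {v = v} {e} eq v' e' rewrite eq v' e' | Bool.∧-comm (does (v' ≟ v)) (does (e' ≟ e)) = refl

filter-cong : ∀ {A : Set} {g h : A → Bool} → (∀ x → g x ≡ h x) → ∀ l →
              filter (λ x → T? (g x)) l ≡ filter (λ x → T? (h x)) l
filter-cong eq [] = refl
filter-cong {g = g} {h} eq (x ∷ l) with g x | h x | eq x
... | true | true | refl = cong (x ∷_) (filter-cong eq l)
... | false | false | refl = filter-cong eq l

module Transfer {n m} (ρ : RibbonData n m) {HT : Graph n m → Set} {HT' : Graph m n → Set}
                (to : ∀ {G G'} → (∀ v e → G' e v ≡ G v e) → HT' G' → HT G)
                (from : ∀ {G G'} → (∀ v e → G' e v ≡ G v e) → HT G → HT' G') where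

  Mirrored : Trav n m → Trav m n → Set
  Mirrored l l' = ∀ v e → ((v , e) ∈ l → (e , v) ∈ l') × ((e , v) ∈ l' → (v , e) ∈ l)

  mirrored-cons : ∀ {l l' v e e'} → e' ≡ e → Mirrored l l' → Mirrored ((v , e) ∷ l) ((e' , v) ∷ l')
  mirrored-cons refl mir v e =
    (λ { (here refl) → here refl ; (there p) → there (proj₁ (mir v e) p) }) ,
    (λ { (here refl) → here refl ; (there p) → there (proj₂ (mir v e) p) })

  nextV-mirror : ∀ {G : Graph n m} {G' : Graph m n} → (∀ v e → G' e v ≡ G v e) → ∀ e v →
                 nextAtV (ρ ᴿ) G' e v ≡ nextAtE ρ G e v
  nextV-mirror eq e v = cong (firstOr v) (filter-cong (λ w → eq w e) (rotAfter v (atE ρ e)))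

  nextE-mirror : ∀ {G : Graph n m} {G' : Graph m n} → (∀ v e → G' e v ≡ G v e) → ∀ v e →
                 nextAtE (ρ ᴿ) G' v e ≡ nextAtV ρ G v e
  nextE-mirror eq v e = cong (firstOr e) (filter-cong (λ d → eq v d) (rotAfter e (atV ρ v)))

  -- Deletion tests the two ends in the opposite order after transposition, so the graphs correspond
  -- only pointwise and the successors only by an equation. Hence the explicit equalities between
  -- the states of the two runs.
  transfer : ∀ {G G' e e' v v' tV tE tV' tE' out'} → CutV.Run HT' (ρ ᴿ) G' e' v' tV' tE' out' →
             e' ≡ e → v' ≡ v → (∀ v e → G' e v ≡ G v e) → Mirrored tE tV' → Mirrored tV tE' →
             ∃[ out ] CutE.Run HT ρ G e v tV tE out × (∀ v e → out' e v ≡ out v e)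
  transfer (CutV.remove h r) refl refl eq mE mV =
    let eq' = ─-mirror eq
        out , r' , same = transfer r refl (nextV-mirror eq' _ _) eq' mE mV
    in out , CutE.remove (to eq' h) r' , same
  transfer {G = G} (CutV.stop₁ ¬h p) refl refl eq mE mV =
    G , CutE.stop₁ (¬h ∘ from (─-mirror eq)) (proj₂ (mE _ _) p) , eq
  transfer {G = G} {e = e} {v = v} {tV = tV} (CutV.stop₂ ¬h q p) refl refl eq mE mV =
    G , CutE.stop₂ (¬h ∘ from (─-mirror eq)) (q ∘ proj₁ (mE _ _))
          (subst (λ d → (v , d) ∈ tV) (nextE-mirror eq v e) (proj₂ (mV _ _) p)) , eq
  transfer {G = G} {e = e} {v = v} {tE' = tE'} (CutV.traverse ¬h q p r) refl refl eq mE mV =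
    let d≡ = nextE-mirror eq v e
        out , r' , same = transfer r d≡ (trans (nextV-mirror eq _ v) (cong (λ d → nextAtE ρ G d v) d≡)) eq
                            (mirrored-cons refl mE) (mirrored-cons d≡ mV)
    in out , CutE.traverse (¬h ∘ from (─-mirror eq)) (q ∘ proj₁ (mE _ _))
               (p ∘ subst (λ d → (d , v) ∈ tE') (sym d≡) ∘ proj₁ (mV _ _)) r' , same

RibbonOf-reverse-mirror : ∀ {n m} {M : Graph n m} {ρ} → RibbonOf M ρ → RibbonOf (M ᵀ) (reverseRibbon ρ ᴿ)
RibbonOf-reverse-mirror (isV , isE) =
  (λ e → Unique-reverse (proj₁ (isE e)) , λ v → reversed (proj₂ (isE e) v)) ,
  (λ v → Unique-reverse (proj₁ (isV v)) , λ e → reversed (proj₂ (isV v) e))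
  where
  reversed : ∀ {k} {l : List (Fin k)} {x} {P : Set} → (x ∈ l) ⇔ P → (x ∈ reverse l) ⇔ P
  reversed iff = mk⇔ (Equivalence.to iff ∘ reverse⁻) (reverse⁺ ∘ Equivalence.from iff)

-- The reversed tour

module Reversed {n m} (M : Graph n m) (ρ : RibbonData n m) (isρ : RibbonOf M ρ)
                (d₀ : Dart n m) (valid₀ : M ∋ d₀ ≡ true) (T : Graph n m) (spanning : SpanningTree M T)
                (jaeger : Jaeger ρ T d₀) where

  open RibbonProperties {M = M} {ρ} isρ
  open Tour M ρ isρ d₀ valid₀ T (proj₁ spanning)
  open OnTree (SpanningTree⇒Tree spanning)

  ρ' : RibbonData m n
  ρ' = reverseRibbon ρ ᴿ

  start : Dart m n
  start = mirror (rot (reverseRibbon ρ) d₀)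

  rot-mirror : ∀ d → rot ρ' (mirror d) ≡ mirror (rot (reverseRibbon ρ) d)
  rot-mirror (vd v e) = refl
  rot-mirror (ed v e) = refl

  flip-mirror : ∀ d → flip (T ᵀ) (mirror d) ≡ mirror (flip T d)
  flip-mirror (vd v e) with T v e
  ... | true = refl
  ... | false = refl
  flip-mirror (ed v e) with T v e
  ... | true = refl
  ... | false = refl

  rot-back : ∀ j → rot (reverseRibbon ρ) (at (suc j)) ≡ flip T (at j)
  rot-back j = trans (cong (rot (reverseRibbon ρ)) (trans (at-suc j) (turn-def ρ T (at j))))
    (rot-reverse (flip T (at j)) (trans (flip-on T M (at j)) (at-valid j)))

  -- Reversed time 0 is the last dart, `j = period-1`, because `d₀` is also the dart of time
  -- `period`. After that, a turn of the reversed tour flips first and so cancels the `flip T` of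
  -- the formula; its rotation then undoes the rotation of the original turn.
  reversed-at : ∀ k j → suc j + k ≡ period → tour ρ' (T ᵀ) start k ≡ mirror (flip T (at j))
  reversed-at zero j eq = trans (tour-zero ρ' (T ᵀ) start) (cong mirror
    (trans (cong (rot (reverseRibbon ρ)) (trans (sym at-period) (cong at (trans (sym eq) (ℕ.+-identityʳ (suc j))))))
           (rot-back j)))
  reversed-at (suc k) j eq = begin
    tour ρ' (T ᵀ) start (suc k)                          ≡⟨ tour-suc ρ' (T ᵀ) start k ⟩
    turn ρ' (T ᵀ) (tour ρ' (T ᵀ) start k)                ≡⟨ cong (turn ρ' (T ᵀ)) (reversed-at k (suc j) (trans (sym (ℕ.+-suc (suc j) k)) eq)) ⟩
    turn ρ' (T ᵀ) (mirror (flip T (at (suc j))))         ≡⟨ turn-def ρ' (T ᵀ) _ ⟩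
    rot ρ' (flip (T ᵀ) (mirror (flip T (at (suc j)))))   ≡⟨ cong (rot ρ') (flip-mirror (flip T (at (suc j)))) ⟩
    rot ρ' (mirror (flip T (flip T (at (suc j)))))       ≡⟨ cong (rot ρ' ∘ mirror) (flip-flip T (at (suc j))) ⟩
    rot ρ' (mirror (at (suc j)))                         ≡⟨ rot-mirror (at (suc j)) ⟩
    mirror (rot (reverseRibbon ρ) (at (suc j)))          ≡⟨ cong mirror (rot-back j) ⟩
    mirror (flip T (at j))                               ∎
    where open ≡-Reasoning

  start-valid : M ᵀ ∋ start ≡ true
  start-valid = trans (mirror-∋ (rot (reverseRibbon ρ) d₀))
    (trans (cong (λ d → M ∋ rot (reverseRibbon ρ) d) (sym at-period))
      (trans (cong (M ∋_) (rot-back period-1)) (trans (flip-on T M (at period-1)) (at-valid period-1))))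
    where
    mirror-∋ : ∀ d → M ᵀ ∋ mirror d ≡ M ∋ d
    mirror-∋ (vd v e) = refl
    mirror-∋ (ed v e) = refl

  flip-off : ∀ d → T ∋ d ≡ false → flip T d ≡ d
  flip-off d off = cong (λ b → oppWhen b d) off

  complement : ∀ {t} → t < period → ∃[ j ] suc j + t ≡ period
  complement {t} t<p = let j , eq = ℕ.m≤n⇒∃[o]m+o≡n t<p in
    j , trans (ℕ.+-comm (suc j) t) (trans (ℕ.+-suc t j) eq)

  mirrored-dart : ∀ {j k v e} → suc j + k ≡ period → T v e ≡ false → tour ρ' (T ᵀ) start k ≡ ed e v → at j ≡ vd v e
  mirrored-dart {j} {k} {v} {e} j+k off eq = begin
    at j                                  ≡⟨ flip-flip T (at j) ⟨
    flip T (flip T (at j))                ≡⟨ cong (flip T) (mirror-mirror (flip T (at j))) ⟨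
    flip T (mirror (mirror (flip T (at j)))) ≡⟨ cong (flip T ∘ mirror) (trans (sym (reversed-at k j j+k)) eq) ⟩
    flip T (vd v e)                       ≡⟨ flip-off (vd v e) off ⟩
    vd v e                                ∎
    where open ≡-Reasoning

  -- If the meeting from `E` came first, the Jaeger property would give another meeting from `V`
  -- before it, but a dart occurs only once in a period.
  V-before-E : ∀ {i j v e} → T v e ≡ false → j < period → at j ≡ vd v e → at i ≡ ed v e → j < i
  V-before-E {i} {j} {v} {e} off j<p at-j at-i with ℕ.<-cmp i j
  ... | tri> _ _ j<i = j<i
  ... | tri≈ _ refl _ with () ← trans (sym at-i) at-j
  V-before-E {i} {j} {v} {e} off j<p at-j at-i | tri< i<j _ _ =
    let h , h<i , at-h = jaeger i v e at-i off
    in ⊥-elim (at-injective (ℕ.<-trans h<i i<j) j<p (trans at-h (sym at-j)))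

  jaeger' : Jaeger ρ' (T ᵀ) start
  jaeger' t e v eq off =
    -- The witness `s` is the reversed time of the original meeting from `E`, which is the meeting
    -- from the first colour class after the exchange.
    let i , i<p , at-i = visited-by-period (ed v e) valid
        s , s+i = complement i<p
        i+s = trans (sym (ℕ.+-suc i s)) (trans (ℕ.+-comm i (suc s)) s+i)
    in s , earlier i s (ℕ.m+n≤o⇒m≤o (suc s) (ℕ.≤-reflexive s+i)) i+s at-i ,
       trans (reversed-at s i i+s) (cong mirror (trans (cong (flip T) at-i) (flip-off (ed v e) off)))
    where
    valid : M v e ≡ true
    valid = subst (λ d → M ᵀ ∋ d ≡ true) eq
      (Tour.at-valid (M ᵀ) ρ' (RibbonOf-reverse-mirror isρ) start start-valid (T ᵀ) (λ e v → proj₁ spanning v e) t)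

    earlier : ∀ i s → s < period → suc i + s ≡ period → at i ≡ ed v e → s < t
    earlier i s s<p i+s at-i with t ℕ.<? period
    ... | no t≮p = ℕ.<-≤-trans s<p (ℕ.≮⇒≥ t≮p)
    ... | yes t<p = ℕ.≰⇒> λ t≤s →
      let j , j+t = complement t<p
          j<i = V-before-E off (ℕ.m+n≤o⇒m≤o (suc j) (ℕ.≤-reflexive j+t)) (mirrored-dart j+t off eq) at-i
      in ℕ.<⇒≢ (ℕ.+-mono-<-≤ (s≤s j<i) t≤s) (trans j+t (sym i+s))

-- From the Jaeger tree to both processes

degV-positive : ∀ {n m} (T : Graph n m) {v e} → T v e ≡ true → 1 ≤ degV T v
degV-positive T {v} {e} p = ℕ.≤-trans
  (ℕ.≤-trans (ℕ.≤-reflexive (sym (sum-at-index e 1))) (sum-mono entry))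
  (ℕ.≤-reflexive (sym (sum-allFin (λ e' → bit (T v e')))))
  where
  entry : ∀ e' → at-index e e' 1 ≤ bit (T v e')
  entry e' with e ≟ e'
  ... | yes refl rewrite p = ℕ.≤-refl
  ... | no _ = z≤n

degV-cong : ∀ {n m} {T T' : Graph n m} → (∀ v e → T v e ≡ T' v e) → ∀ v → degV T v ≡ degV T' v
degV-cong eq v = cong ListAction.sum (List.map-cong (λ e → cong bit (eq v e)) (List.allFin _))

dartOf : ∀ {n m} → Base n m → Dart n m
dartOf (baseV v e) = vd v e
dartOf (baseE e v) = ed v e

module FromJaeger {n m} (M : Graph n m) (ρ : RibbonData n m) (isρ : RibbonOf M ρ)
                  (d₀ : Dart n m) (valid₀ : M ∋ d₀ ≡ true) (T : Graph n m) (spanning : SpanningTree M T)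
                  (jaeger : Jaeger ρ T d₀) (g : Fin n → ℕ) (degrees : ∀ v → degV T v ≡ suc (g v)) where

  open Reversed M ρ isρ d₀ valid₀ T spanning jaeger

  HT : Graph n m → Set
  HT G = IsHypertreeV G g

  HT' : Graph m n → Set
  HT' G = IsHypertreeE G g

  to : ∀ {G G'} → (∀ v e → G' e v ≡ G v e) → HT' G' → HT G
  to eq (S , spanS , deg) = S ᵀ , SpanningTree-mirror (λ e v p → trans (sym (eq v e)) p) spanS , deg

  from : ∀ {G G'} → (∀ v e → G' e v ≡ G v e) → HT G → HT' G'
  from eq (S , spanS , deg) = S ᵀ , SpanningTree-mirror (λ v e p → trans (eq v e) p) spanS , deg

  open Transfer (reverseRibbon ρ) {HT} {HT'} to from
  open JaegerRun (M ᵀ) ρ' (RibbonOf-reverse-mirror isρ) start start-valid (T ᵀ)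
         (SpanningTree-mirror (λ v e p → p) spanning) jaeger' g degrees using (outcome)
  open RibbonProperties {M = M} {ρ} isρ

  -- After the exchange a base node in `V` becomes one in `E`. In that case the base edge counts as
  -- traversed on both sides, so the lists matched by `transfer` start with one entry.
  reverse-outcome : ∀ b → dartOf b ≡ d₀ →
    ∃[ out ] CutE.Outcome HT (reverseRibbon ρ) M (basePred ρ M b) out × (∀ v e → out v e ≡ T v e)
  reverse-outcome (baseV v e) refl =
    let out' , r , same = outcome _ refl
        out , r' , same' = transfer r refl (nextV-mirror {M} {M ᵀ} (λ _ _ → refl) _ v) (λ _ _ → refl)
                             (λ _ _ → (λ ()) , (λ ())) (mirrored-cons refl (λ _ _ → (λ ()) , (λ ())))
    in out ,
       subst (λ d → CutE.Outcome HT (reverseRibbon ρ) M (baseV v d) out) (sym pred) r' ,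
       λ v e → trans (sym (same' v e)) (same e v)
    where
    pred : nextAtV (reverseRibbon ρ) M v e ≡ next (reverse (atV ρ v)) e
    -- The ribbon at `v` lists exactly its neighbours in `M`, so filtering by `M` removes nothing
    -- and the predecessor is that of the reversed tour.
    pred = filter-next (M v) (Unique-reverse (uniqueV v)) (reverse⁺ (∈V valid₀)) (∈V⁻ ∘ reverse⁻)
  reverse-outcome (baseE e v) refl =
    let out' , r , same = outcome _ refl
        out , r' , same' = transfer r refl refl (λ _ _ → refl) (λ _ _ → (λ ()) , (λ ())) (λ _ _ → (λ ()) , (λ ()))
    in out ,
       subst (λ w → CutE.Outcome HT (reverseRibbon ρ) M (baseE e w) out) (sym pred) r' ,
       λ v e → trans (sym (same' v e)) (same e v)
    where
    pred : nextAtE (reverseRibbon ρ) M e v ≡ next (reverse (atE ρ e)) v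
    pred = filter-next (λ w → M w e) (Unique-reverse (uniqueE e)) (reverse⁺ (∈E valid₀)) (∈E⁻ ∘ reverse⁻)

theorem6p21 : (H : Hypergraph) → Connected (mem H) →
    (ρ : RibbonData (nV H) (nE H)) → IsRibbon H ρ →
    (b : Base (nV H) (nE H)) → BaseOK H b →
    (f : Fin (nE H) → ℕ) → IsHypertreeE (mem H) f →
    (T : Graph (nV H) (nE H)) → BernardiEV H ρ b f T →
    ∃[ T' ] (BernardiVE H (reverseRibbon ρ) (basePred ρ (mem H) b) (fV T) T'
    × (∀ v e → T' v e ≡ T v e))
theorem6p21 H _ ρ isρ b ok f (T₀ , spanning₀ , degrees₀) T run =
  let T* , spanning , degrees , jaeger =
        Improve.jaeger-realisation (mem H) ρ isρ (dartOf b) (valid b ok) _ T₀ spanning₀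
          (ℕ.m≤n+m (2 ^ (2 * (nV H * nE H))) _)
      out , run* , out≗T* = JaegerRun.outcome (mem H) ρ isρ (dartOf b) (valid b ok) T* spanning jaeger f
        (λ e → trans (degrees e) (degrees₀ e)) (dartOf b) refl
      T≗T* = λ v e → trans (cong (λ S → S v e) (deterministic b run run*)) (out≗T* v e)
      T' , run' , T'≗T* = FromJaeger.reverse-outcome (mem H) ρ isρ (dartOf b) (valid b ok) T* spanning jaeger (fV T)
        (λ v → trans (sym (degV-cong T≗T* v)) (sym (pred-degree T* spanning T≗T* v))) b refl
  in T' , run' , λ v e → trans (T'≗T* v e) (sym (T≗T* v e))
  where
  valid : ∀ b → BaseOK H b → mem H ∋ dartOf b ≡ true
  valid (baseV v e) ok = ok
  valid (baseE e v) ok = ok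
  someE : ∀ {n m} → Base n m → Fin m
  someE (baseV v e) = e
  someE (baseE e v) = e
  pred-degree : ∀ T* → SpanningTree (mem H) T* → (∀ v e → T v e ≡ T* v e) → ∀ v → suc (fV T v) ≡ degV T v
  pred-degree T* (_ , conn , _) T≗T* v =
    -- A walk from any node of `E` to `v` ends with an edge at `v`. So the degree is positive, and
    -- the truncated subtraction in `fV` is exact.
    let e , T*ve = neighbourE (conn (inj₂ (someE b)) (inj₁ v))
    in ℕ.m+[n∸m]≡n (degV-positive T (trans (T≗T* v e) T*ve))
  deterministic : ∀ b {out out'} → BernardiEV H ρ b f out → BernardiEV H ρ (baseOf (dartOf b)) f out' → out ≡ out'
  deterministic (baseV v e) = run-deterministic
  deterministic (baseE e v) = run-deterministic
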